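{- Let $n$ and $k\ge 2$ be positive integers. Suppose there exist sets $A_1,\dots,A_k$ that are pairwise disjoint, each MSTD and $P_n$, with $\bigcup_{i=1}^k A_i=[0,2n-1]$. Write $A_i=L_i\cup R_i$ with $L_i\subseteq[0,n-1]$ and $R_i\subseteq[n,2n-1]$. For each $i$, let $a_i$ be the smallest integer such that $[n,2n-a_i]\subseteq L_i+L_i$ and $[2n+a_i-2,3n-2]\subseteq R_i+R_i$, let $\tau(L_i)=|\{x\in L_i:x\le n-a_i+1\}|$, $\tau(R_i)=|\{x\in R_i:x\ge n+a_i-2\}|$, and $$f(L_i,R_i)=(a_i-2)\big(2^{ -\tau(R_i)}+2^{ -\tau(L_i)}\big)+6\big(2^{ -|L_i|}+2^{ -|R_i|}\big).$$ For an integer $m\ge 0$, let $R_i'=R_i+m$, and for a $k$-tuple $(M_1,\dots,M_k)$ of pairwise disjoint sets with $\bigcup_{i=1}^k M_i=[n,n+m-1]$, let $S_i=L_i\cup M_i\cup R_i'$. If $1-\sum_{i=1}^k f(L_i,R_i)>0$, then there exist a constant $c>0$ and $m_0$ such that for all $m\ge m_0$, the proportion of such $k$-tuples $(M_1,\dots,M_k)$ for which all of $S_1,\dots,S_k$ are MSTD is at least $c$. In other words, there is a positive constant lower bound for the proportion of $k$-decompositions into MSTD subsets of this form as $m\to\infty$.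
   Context: For integers $a\le b$, $[a,b]=\{x\in\mathbb{Z}:a\le x\le b\}$ (empty if $a>b$). For a set $A$ of integers, $A+A=\{x+y:x,y\in A\}$, $A-A=\{x-y:x,y\in A\}$, $A+t=\{x+t:x\in A\}$. A finite set $A$ is MSTD if $|A+A|>|A-A|$. A finite set $A$ with $a=\min A$, $b=\max A$ is $P_n$ if $A+A\supseteq[2a+n,2b-n]$ and $A-A\supseteq[(a-b)+n,(b-a)-n]$. -}

module Defs where

open import Data.Nat as ℕ using (ℕ; zero; suc)
open import Data.Integer as ℤ using (ℤ; +_; _+_; _-_; _≤_; _<_; _≤?_; _<?_)
import Data.Rational as ℚ
open import Data.Rational using (ℚ; 0ℚ; 1ℚ; ½)
open import Data.Fin using (Fin; toℕ)
open import Data.Fin.Properties using (all?)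
open import Data.Vec using (Vec; []; _∷_; lookup)
open import Data.List using (List; []; _∷_; _∷ʳ_; length; filter; deduplicate; cartesianProductWith; map; concatMap; allFin; foldr)
open import Data.List.Membership.Propositional using (_∈_)
open import Data.Product using (_×_; Σ)
open import Relation.Nullary using (¬_; Dec; does)
open import Relation.Binary.PropositionalEquality using (_≡_)

-- Finite sets of integers are represented by lists (duplicates allowed);
-- membership is list membership, cardinality counts distinct elements.
card : List ℤ → ℕ
card A = length (deduplicate ℤ._≟_ A)

_⊕_ : List ℤ → List ℤ → List ℤ
A ⊕ B = cartesianProductWith _+_ A B

_⊖_ : List ℤ → List ℤ → List ℤ
A ⊖ B = cartesianProductWith _-_ A B

shift : ℤ → List ℤ → List ℤ
shift t A = map (λ x → x + t) A

MSTD : List ℤ → Set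
MSTD A = card (A ⊖ A) ℕ.< card (A ⊕ A)

MSTD? : (A : List ℤ) → Dec (MSTD A)
MSTD? A = card (A ⊖ A) ℕ.<? card (A ⊕ A)

IsMin : ℤ → List ℤ → Set
IsMin a A = a ∈ A × (∀ x → x ∈ A → a ≤ x)

IsMax : ℤ → List ℤ → Set
IsMax b A = b ∈ A × (∀ x → x ∈ A → x ≤ b)

InInterval : ℤ → ℤ → ℤ → Set
InInterval lo hi x = lo ≤ x × x ≤ hi

P : ℕ → List ℤ → Set
P n A = ∀ a b → IsMin a A → IsMax b A →
  (∀ x → InInterval ((a + a) + + n) ((b + b) - + n) x → x ∈ (A ⊕ A)) ×
  (∀ x → InInterval ((a - b) + + n) ((b - a) - + n) x → x ∈ (A ⊖ A))

-- L = A ∩ [0,n-1], R = A ∩ [n,2n-1] (A ⊆ [0,2n-1] in the theorem)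
Lpart : ℕ → List ℤ → List ℤ
Lpart n A = filter (λ x → x <? + n) A

Rpart : ℕ → List ℤ → List ℤ
Rpart n A = filter (λ x → + n ≤? x) A

Good : ℕ → List ℤ → List ℤ → ℤ → Set
Good n L R a =
  (∀ x → InInterval (+ n) ((+ n + + n) - a) x → x ∈ (L ⊕ L)) ×
  (∀ x → InInterval (((+ n + + n) + a) - + 2) ((+ n + + n + + n) - + 2) x → x ∈ (R ⊕ R))

IsLeast : (ℤ → Set) → ℤ → Set
IsLeast Q a = Q a × (∀ b → Q b → a ≤ b)

τL : ℕ → ℤ → List ℤ → ℕ
τL n a L = card (filter (λ x → x ≤? (+ n - a) + + 1) L)

τR : ℕ → ℤ → List ℤ → ℕ
τR n a R = card (filter (λ x → (+ n + a) - + 2 ≤? x) R)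

pow2inv : ℕ → ℚ
pow2inv zero = 1ℚ
pow2inv (suc t) = ½ ℚ.* pow2inv t

toℚ : ℤ → ℚ
toℚ z = z ℚ./ 1

f : ℕ → ℤ → List ℤ → List ℤ → ℚ
f n a L R =
  (toℚ (a - + 2) ℚ.* (pow2inv (τR n a R) ℚ.+ pow2inv (τL n a L)))
  ℚ.+ (toℚ (+ 6) ℚ.* (pow2inv (card L) ℚ.+ pow2inv (card R)))

sumFin : (k : ℕ) → (Fin k → ℚ) → ℚ
sumFin k g = foldr (λ i acc → g i ℚ.+ acc) 0ℚ (allFin k)

-- All k-tuples (M_1,…,M_k) of pairwise disjoint sets with union [n, n+m-1]
-- are encoded (bijectively) by colourings v : Vec (Fin k) m, where
-- n + j ∈ M_i  iff  lookup v j ≡ i.  allColourings lists each colouring once.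
allColourings : (k m : ℕ) → List (Vec (Fin k) m)
allColourings k zero = [] ∷ []
allColourings k (suc m) = concatMap (λ v → map (λ c → c ∷ v) (allFin k)) (allColourings k m)

colourClass : {k m : ℕ} → ℕ → Vec (Fin k) m → Fin k → List ℤ
colourClass {k} {m} n v i =
  map (λ j → + n + + toℕ j) (filter (λ j → lookup v j Data.Fin.≟ i) (allFin m))

Sset : {k m : ℕ} → ℕ → (Fin k → List ℤ) → Vec (Fin k) m → Fin k → List ℤ
Sset {k} {m} n A v i =
  Lpart n (A i) Data.List.++ (colourClass n v i Data.List.++ shift (+ m) (Rpart n (A i)))

goodCount : (n k : ℕ) → (Fin k → List ℤ) → (m : ℕ) → ℕ
goodCount n k A m =
  length (filter (λ v → all? (λ i → MSTD? (Sset n A v i))) (allColourings k m))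

{-# OPTIONS --safe #-}
module Submission where

-- Write positions from the left as x and from the right as z = W - x, where W = 2n + m - 1. Fix the
-- colours of a long left fringe and a long right fringe, both periodic with the same period p,
-- so that x and z in the fringes never share a colour when x + z ≡ -1 (mod p). Then no colour class
-- has the differences ±(W - (j p - 1)) for 1 ≤ j ≤ R, where R p is the length of a fringe. The number of
-- sums that a class misses, on the other hand, can be bounded independently of R: the period is laid
-- out so that each class contains a basis modulo p, and the part of a class in the middle, which is
-- left free, misses few sums on average, because a sum with q disjoint representations is missed
-- with probability at most (1 - 1/k²)^q. With R large, a positive proportion of the colourings is
-- therefore MSTD in all classes. All that is needed about the A_i is that they partition [0, 2n - 1].

open import Defs
open import Data.Nat as ℕ using (ℕ; zero; suc; _+_; _*_; _∸_; _^_; _≤_; _<_; z≤n; s≤s; NonZero)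
open import Data.Nat.Properties
open import Data.Nat.DivMod
open import Data.Nat.Divisibility using (n∣m*n)
open import Data.Nat.ListAction using (sum)
open import Data.Nat.ListAction.Properties using (sum-++)
open import Data.Nat.Solver using (module +-*-Solver)
open import Data.Integer as ℤ using (ℤ; +_)
import Data.Integer.Properties as ℤₚ
import Data.Rational as ℚ
open import Data.Rational using (ℚ; 0ℚ; 1ℚ)
import Data.Rational.Properties as ℚₚ
import Data.Rational.Unnormalised as ℚᵘ
import Data.Rational.Unnormalised.Properties as ℚᵘₚ
open import Data.Fin as Fin using (Fin; toℕ)
open import Data.Fin.Patterns
open import Data.Fin.Properties using (all?; toℕ<n; toℕ-injective; toℕ-fromℕ<; toℕ-inject₁)
open import Data.Fin.Relation.Unary.Top using (view; ‵fromℕ; ‵inject₁)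
open import Data.List using (List; []; _∷_; _++_; length; map; filter; upTo; applyUpTo; allFin; concatMap; deduplicate)
open import Data.List.Properties using (length-++; length-map; length-upTo; length-applyUpTo; length-tabulate; map-∘; map-++; map-cong; upTo-∷ʳ)
open import Data.List.Membership.Propositional using (_∈_)
open import Data.List.Membership.Propositional.Properties
import Data.List.Relation.Unary.All as All
open import Data.List.Relation.Unary.Any using (here; there)
open import Data.List.Relation.Unary.Unique.Propositional using (Unique; []; _∷_)
import Data.List.Relation.Unary.Unique.Propositional.Properties as Uniqueₚ
open import Data.List.Relation.Unary.Unique.DecPropositional.Properties using (deduplicate-!)
open import Data.Vec as Vec using (Vec; []; _∷_; _∷ʳ_; lookup; tabulate; reverse)
open import Data.Vec.Properties using (reverse-∷)
open import Data.Product using (_×_; _,_; ∃-syntax; proj₁; proj₂)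
open import Data.Sum using (_⊎_; inj₁; inj₂)
open import Data.Empty using (⊥; ⊥-elim)
open import Function using (_∘_; id)
open import Relation.Nullary using (¬_; Dec; yes; no; ¬?; _×-dec_; contradiction)
open import Relation.Binary.PropositionalEquality using (_≡_; _≢_; refl; sym; trans; cong; cong₂; subst; module ≡-Reasoning)

-- Counting sums and differences

-- The two demands on the fringes do not conflict because they concern different pairs. A difference
-- close to W or -W compares a position counted from the left with one counted from the right,
-- whereas small sums use two positions at the left end and large sums two at the right end. So the
-- right pattern can be a fixed-point-free recolouring of the mirrored left pattern, while the left
-- pattern is made as rich in sums as desired. The obstacle is that the outermost n colours at
-- either end are dictated by the A_i and arbitrary: each end needs a block that tolerates any
-- colours, and the block facing it has to be derived from it. The period p = 10 k (n + k) is fixed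
-- by n and k, so R can be chosen after p. A class misses at most 4 + 8 p + 4 k³ sums, where 4 + 8 p
-- comes from the borders of the two fringes and 4 k³ from the middle; this competes with 2 R absent
-- differences. The number of prescribed colours does not depend on m, so prescribing them costs
-- only a constant factor.

unique-⊆⇒length≤ : ∀ {a} {A : Set a} {xs ys : List A} →
  Unique xs → (∀ {x} → x ∈ xs → x ∈ ys) → length xs ≤ length ys
unique-⊆⇒length≤ [] _ = z≤n
unique-⊆⇒length≤ {xs = x ∷ xs} (x∉xs ∷ u) xs⊆ys with ∈-∃++ (xs⊆ys (here refl))
... | as , bs , refl = begin
    suc (length xs)               ≤⟨ s≤s (unique-⊆⇒length≤ u xs⊆as++bs) ⟩
    suc (length (as ++ bs))       ≡⟨ cong suc (length-++ as) ⟩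
    suc (length as + length bs)   ≡⟨ sym (+-suc (length as) (length bs)) ⟩
    length as + suc (length bs)   ≡⟨ sym (length-++ as) ⟩
    length (as ++ x ∷ bs)         ∎
  where
  open ≤-Reasoning
  xs⊆as++bs : ∀ {y} → y ∈ xs → y ∈ as ++ bs
  xs⊆as++bs y∈xs with ∈-++⁻ as (xs⊆ys (there y∈xs))
  ... | inj₁ y∈as = ∈-++⁺ˡ y∈as
  ... | inj₂ (here y≡x) = ⊥-elim (All.lookup x∉xs y∈xs (sym y≡x))
  ... | inj₂ (there y∈bs) = ∈-++⁺ʳ as y∈bs

∈-⊖-swap : ∀ S {d} → d ∈ S ⊖ S → ℤ.- d ∈ S ⊖ S
∈-⊖-swap S d∈ with ∈-cartesianProductWith⁻ ℤ._-_ S S d∈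
... | x , y , x∈ , y∈ , refl =
  subst (_∈ S ⊖ S) (sym (trans (ℤₚ.neg-distrib-+ x (ℤ.- y)) (trans (cong (ℤ._+_ (ℤ.- x)) (ℤₚ.neg-involutive y)) (ℤₚ.+-comm (ℤ.- x) y))))
    (∈-cartesianProductWith⁺ ℤ._-_ y∈ x∈)

module Criterion (S : List ℤ) (W : ℕ) (S⊆[0,W] : ∀ {x} → x ∈ S → ∃[ u ] u ≤ W × x ≡ + u) where

  -- `missing` may repeat entries or list sums that do occur: only its length enters, as an upper
  -- bound for what is absent from [0, 2W].
  card-sums : (missing : List ℕ) → (∀ s → s ≤ W + W → s ∈ missing ⊎ + s ∈ S ⊕ S) →
    suc (W + W) ≤ card (S ⊕ S) + length missing
  card-sums missing covered = begin
    suc (W + W)                               ≡⟨ sym (trans (length-map +_ (upTo (suc (W + W)))) (length-upTo (suc (W + W)))) ⟩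
    length (map +_ (upTo (suc (W + W))))      ≤⟨ unique-⊆⇒length≤ (Uniqueₚ.map⁺ ℤₚ.+-injective (Uniqueₚ.upTo⁺ _)) ⊆ ⟩
    length (distinct ++ map +_ missing)       ≡⟨ length-++ distinct ⟩
    length distinct + length (map +_ missing) ≡⟨ cong (length distinct ℕ.+_) (length-map +_ missing) ⟩
    length distinct + length missing          ∎
    where
    open ≤-Reasoning
    distinct = deduplicate ℤ._≟_ (S ⊕ S)
    ⊆ : ∀ {z} → z ∈ map +_ (upTo (suc (W + W))) → z ∈ distinct ++ map +_ missing
    ⊆ z∈ with ∈-map⁻ +_ z∈
    ... | s , s∈ , refl with covered s (≤-pred (∈-upTo⁻ s∈))
    ... | inj₁ s∈missing = ∈-++⁺ʳ distinct (∈-map⁺ +_ s∈missing)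
    ... | inj₂ s∈S⊕S = ∈-++⁺ˡ (∈-deduplicate⁺ ℤ._≟_ s∈S⊕S)

  diff-bounded : ∀ {d} → d ∈ S ⊖ S → ∃[ j ] j ≤ W + W × d ≡ + j ℤ.- + W
  diff-bounded d∈ with ∈-cartesianProductWith⁻ ℤ._-_ S S d∈
  ... | x , y , x∈ , y∈ , refl with S⊆[0,W] x∈ | S⊆[0,W] y∈
  ... | u , u≤W , refl | v , v≤W , refl = (W ∸ v) + u , +-mono-≤ (m∸n≤m W v) u≤W , eq
    where
    open ≡-Reasoning
    eq : + u ℤ.- + v ≡ + ((W ∸ v) + u) ℤ.- + W
    eq = begin
      + u ℤ.- + v                        ≡⟨ ℤₚ.m-n≡m⊖n u v ⟩
      u ℤ.⊖ v                            ≡⟨ sym (ℤₚ.+-cancelˡ-⊖ (W ∸ v) u v) ⟩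
      ((W ∸ v) + u) ℤ.⊖ ((W ∸ v) + v)    ≡⟨ cong (ℤ._⊖_ ((W ∸ v) + u)) (m∸n+n≡m v≤W) ⟩
      ((W ∸ v) + u) ℤ.⊖ W                ≡⟨ sym (ℤₚ.m-n≡m⊖n ((W ∸ v) + u) W) ⟩
      + ((W ∸ v) + u) ℤ.- + W            ∎

  -- Differences lie among the 2W + 1 integers of [-W, W], and a difference is absent together with
  -- its negative, so each entry counts twice. Positivity keeps the two copies apart.
  card-diffs : (absent : List ℕ) → Unique absent →
    (∀ {d} → d ∈ absent → 0 < d × d ≤ W × ¬ (+ d ∈ S ⊖ S)) →
    card (S ⊖ S) + (length absent + length absent) ≤ suc (W + W)
  card-diffs absent absent! spec = begin
    length distinct + (length absent + length absent)
      ≡⟨ cong (length distinct ℕ.+_) (sym (cong₂ _+_ (length-map +_ absent) (length-map neg absent))) ⟩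
    length distinct + (length pos + length (map neg absent))
      ≡⟨ cong (length distinct ℕ.+_) (sym (length-++ pos)) ⟩
    length distinct + length (pos ++ map neg absent)
      ≡⟨ sym (length-++ distinct) ⟩
    length (distinct ++ pos ++ map neg absent)
      ≤⟨ unique-⊆⇒length≤ all! ⊆ ⟩
    length (map centre (upTo (suc (W + W))))
      ≡⟨ trans (length-map centre (upTo (suc (W + W)))) (length-upTo (suc (W + W))) ⟩
    suc (W + W) ∎
    where
    open ≤-Reasoning
    distinct = deduplicate ℤ._≟_ (S ⊖ S)
    neg : ℕ → ℤ
    neg d = ℤ.- (+ d)
    pos = map +_ absent
    centre : ℕ → ℤ
    centre j = + j ℤ.- + W
    all! : Unique (distinct ++ pos ++ map neg absent)
    all! = Uniqueₚ.++⁺ (deduplicate-! ℤ._≟_ (S ⊖ S))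
      (Uniqueₚ.++⁺ (Uniqueₚ.map⁺ ℤₚ.+-injective absent!)
        (Uniqueₚ.map⁺ (ℤₚ.+-injective ∘ ℤₚ.neg-injective) absent!) disj₂) disj₁
      where
      disj₂ : ∀ {z} → ¬ (z ∈ pos × z ∈ map neg absent)
      disj₂ (z∈ , z∈′) with ∈-map⁻ +_ z∈ | ∈-map⁻ neg z∈′
      ... | d , d∈ , refl | suc e , e∈ , ()
      ... | zero , d∈ , refl | zero , e∈ , eq = <-irrefl refl (proj₁ (spec d∈))
      disj₁ : ∀ {z} → ¬ (z ∈ distinct × z ∈ pos ++ map neg absent)
      disj₁ (z∈ , z∈′) with ∈-deduplicate⁻ ℤ._≟_ (S ⊖ S) z∈ | ∈-++⁻ pos z∈′
      ... | z∈S⊖S | inj₁ q with ∈-map⁻ +_ q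
      ... | d , d∈ , refl = proj₂ (proj₂ (spec d∈)) z∈S⊖S
      disj₁ (z∈ , z∈′) | z∈S⊖S | inj₂ q with ∈-map⁻ neg q
      ... | d , d∈ , refl = proj₂ (proj₂ (spec d∈))
              (subst (_∈ S ⊖ S) (ℤₚ.neg-involutive (+ d)) (∈-⊖-swap S z∈S⊖S))
    ⊆ : ∀ {z} → z ∈ distinct ++ pos ++ map neg absent → z ∈ map centre (upTo (suc (W + W)))
    ⊆ z∈ with ∈-++⁻ distinct z∈
    ... | inj₁ q with diff-bounded (∈-deduplicate⁻ ℤ._≟_ (S ⊖ S) q)
    ... | j , j≤ , refl = ∈-map⁺ centre (∈-upTo⁺ (s≤s j≤))
    ⊆ z∈ | inj₂ q with ∈-++⁻ pos q
    ... | inj₁ r with ∈-map⁻ +_ r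
    ... | d , d∈ , refl = subst (_∈ map centre (upTo (suc (W + W)))) eq
            (∈-map⁺ centre (∈-upTo⁺ (s≤s (+-monoˡ-≤ W (proj₁ (proj₂ (spec d∈)))))))
      where
      eq : + (d + W) ℤ.- + W ≡ + d
      eq = trans (ℤₚ.m-n≡m⊖n (d + W) W) (trans (ℤₚ.⊖-≥ (m≤n+m W d)) (cong +_ (m+n∸n≡m d W)))
    ⊆ z∈ | inj₂ q | inj₂ r with ∈-map⁻ neg r
    ... | d , d∈ , refl = subst (_∈ map centre (upTo (suc (W + W)))) eq
            (∈-map⁺ centre (∈-upTo⁺ (s≤s (≤-trans (m∸n≤m W d) (m≤m+n W W)))))
      where
      d≤W = proj₁ (proj₂ (spec d∈))
      eq : + (W ∸ d) ℤ.- + W ≡ neg d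
      eq = trans (ℤₚ.m-n≡m⊖n (W ∸ d) W)
             (trans (ℤₚ.⊖-≤ (m∸n≤m W d)) (cong (λ e → ℤ.- (+ e)) (m∸[m∸n]≡n d≤W)))

  -- Both counts are measured against 2W + 1, which cancels.
  mstd : (absent missing : List ℕ) → Unique absent →
    (∀ {d} → d ∈ absent → 0 < d × d ≤ W × ¬ (+ d ∈ S ⊖ S)) →
    (∀ s → s ≤ W + W → s ∈ missing ⊎ + s ∈ S ⊕ S) →
    length missing < length absent + length absent → MSTD S
  mstd absent missing absent! spec covered fewer =
    +-cancelʳ-< (length absent + length absent) (card (S ⊖ S)) (card (S ⊕ S))
      (≤-<-trans (≤-trans (card-diffs absent absent! spec) (card-sums missing covered))
        (+-monoʳ-< (card (S ⊕ S)) fewer))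

-- Averaging over colourings

∑ : ∀ {a} {A : Set a} → List A → (A → ℕ) → ℕ
∑ xs g = sum (map g xs)

𝟙 : ∀ {a} {A : Set a} → Dec A → ℕ
𝟙 (yes _) = 1
𝟙 (no  _) = 0

module _ {a} {A : Set a} where

  ∑-cong : ∀ (xs : List A) {g h} → (∀ x → g x ≡ h x) → ∑ xs g ≡ ∑ xs h
  ∑-cong xs g≗h = cong sum (map-cong g≗h xs)

  ∑-mono : ∀ (xs : List A) {g h} → (∀ x → g x ≤ h x) → ∑ xs g ≤ ∑ xs h
  ∑-mono []       g≤h = z≤n
  ∑-mono (x ∷ xs) g≤h = +-mono-≤ (g≤h x) (∑-mono xs g≤h)

  ∑-distrib-+ : ∀ (xs : List A) g h → ∑ xs (λ x → g x + h x) ≡ ∑ xs g + ∑ xs h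
  ∑-distrib-+ []       g h = refl
  ∑-distrib-+ (x ∷ xs) g h = trans (cong ((g x + h x) ℕ.+_) (∑-distrib-+ xs g h))
    (solve 4 (λ a b c d → (a :+ b) :+ (c :+ d) := (a :+ c) :+ (b :+ d)) refl (g x) (h x) (∑ xs g) (∑ xs h))
    where open +-*-Solver

  ∑-distribˡ-* : ∀ (xs : List A) c g → ∑ xs (λ x → c * g x) ≡ c * ∑ xs g
  ∑-distribˡ-* []       c g = sym (*-zeroʳ c)
  ∑-distribˡ-* (x ∷ xs) c g = trans (cong (c * g x ℕ.+_) (∑-distribˡ-* xs c g))
    (sym (*-distribˡ-+ c (g x) (∑ xs g)))

  ∑-const : ∀ (xs : List A) c → ∑ xs (λ _ → c) ≡ length xs * c
  ∑-const []       c = refl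
  ∑-const (x ∷ xs) c = cong (c ℕ.+_) (∑-const xs c)

  ∈⇒≤∑ : ∀ {xs : List A} {x} g → x ∈ xs → g x ≤ ∑ xs g
  ∈⇒≤∑ g (here refl)          = m≤m+n _ _
  ∈⇒≤∑ {y ∷ _} g (there x∈xs) = ≤-trans (∈⇒≤∑ g x∈xs) (m≤n+m _ (g y))

  length-filter-∑ : ∀ {p} {P : A → Set p} (P? : ∀ x → Dec (P x)) xs →
    length (filter P? xs) ≡ ∑ xs (𝟙 ∘ P?)
  length-filter-∑ P? []       = refl
  length-filter-∑ P? (x ∷ xs) with P? x
  ... | yes _ = cong suc (length-filter-∑ P? xs)
  ... | no  _ = length-filter-∑ P? xs

module _ {a b} {A : Set a} {B : Set b} where

  ∑-swap : ∀ (xs : List A) (ys : List B) (g : A → B → ℕ) →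
    ∑ xs (λ x → ∑ ys (g x)) ≡ ∑ ys (λ y → ∑ xs (λ x → g x y))
  ∑-swap []       ys g = sym (trans (∑-const ys 0) (*-zeroʳ (length ys)))
  ∑-swap (x ∷ xs) ys g = trans (cong (∑ ys (g x) ℕ.+_) (∑-swap xs ys g))
    (sym (∑-distrib-+ ys (g x) _))

  ∑-concatMap : ∀ (xs : List A) (h : A → List B) g → ∑ (concatMap h xs) g ≡ ∑ xs (λ x → ∑ (h x) g)
  ∑-concatMap []       h g = refl
  ∑-concatMap (x ∷ xs) h g = trans (cong sum (map-++ g (h x) (concatMap h xs)))
    (trans (sum-++ (map g (h x)) _) (cong (∑ (h x) g ℕ.+_) (∑-concatMap xs h g)))

𝟙-mono : ∀ {a b} {A : Set a} {B : Set b} (A? : Dec A) (B? : Dec B) → (A → B) → 𝟙 A? ≤ 𝟙 B?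
𝟙-mono (no  _) _       _   = z≤n
𝟙-mono (yes _) (yes _) _   = s≤s z≤n
𝟙-mono (yes x) (no ¬y) A→B = ⊥-elim (¬y (A→B x))

𝟙≤1 : ∀ {a} {A : Set a} (A? : Dec A) → 𝟙 A? ≤ 1
𝟙≤1 (yes _) = ≤-refl
𝟙≤1 (no  _) = z≤n

module Colourings (k : ℕ) where

  ∑c : (m : ℕ) → (Vec (Fin k) m → ℕ) → ℕ
  ∑c m = ∑ (allColourings k m)

  ∑-colours : (Fin k → ℕ) → ℕ
  ∑-colours = ∑ (allFin k)

  ∑c-∷ : ∀ m g → ∑c (suc m) g ≡ ∑c m (λ v → ∑-colours (λ c → g (c ∷ v)))
  ∑c-∷ m g = trans (∑-concatMap (allColourings k m) _ g)
    (∑-cong (allColourings k m) (λ v → cong sum (sym (map-∘ (allFin k)))))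

  -- `allColourings` grows at the front; splitting off the last colour as well is what allows both
  -- ends to be peeled at once, and a colouring to be reversed.
  ∑c-∷ʳ : ∀ m g → ∑c (suc m) g ≡ ∑c m (λ v → ∑-colours (λ c → g (v ∷ʳ c)))
  ∑c-∷ʳ zero    g = ∑c-∷ zero g
  ∑c-∷ʳ (suc m) g = begin
    ∑c (suc (suc m)) g
      ≡⟨ ∑c-∷ (suc m) g ⟩
    ∑c (suc m) (λ v → ∑-colours (λ c → g (c ∷ v)))
      ≡⟨ ∑c-∷ʳ m _ ⟩
    ∑c m (λ v → ∑-colours (λ d → ∑-colours (λ c → g (c ∷ (v ∷ʳ d)))))
      ≡⟨ ∑-cong (allColourings k m) (λ v → ∑-swap (allFin k) (allFin k) (λ d c → g (c ∷ (v ∷ʳ d)))) ⟩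
    ∑c m (λ v → ∑-colours (λ c → ∑-colours (λ d → g (c ∷ (v ∷ʳ d)))))
      ≡⟨ sym (∑c-∷ m _) ⟩
    ∑c (suc m) (λ v → ∑-colours (λ d → g (v ∷ʳ d)))
      ∎
    where open ≡-Reasoning

  ∑c-reverse : ∀ m g → ∑c m (g ∘ reverse) ≡ ∑c m g
  ∑c-reverse zero    g = refl
  ∑c-reverse (suc m) g = begin
    ∑c (suc m) (g ∘ reverse)
      ≡⟨ ∑c-∷ m _ ⟩
    ∑c m (λ v → ∑-colours (λ c → g (reverse (c ∷ v))))
      ≡⟨ ∑-cong (allColourings k m) (λ v → ∑-cong (allFin k) (λ c → cong g (reverse-∷ c v))) ⟩
    ∑c m (λ v → ∑-colours (λ c → g (reverse v ∷ʳ c)))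
      ≡⟨ ∑c-reverse m (λ v → ∑-colours (λ c → g (v ∷ʳ c))) ⟩
    ∑c m (λ v → ∑-colours (λ c → g (v ∷ʳ c)))
      ≡⟨ sym (∑c-∷ʳ m g) ⟩
    ∑c (suc m) g ∎
    where open ≡-Reasoning

  ∑-colours-const : ∀ c → ∑-colours (λ _ → c) ≡ k * c
  ∑-colours-const c = trans (∑-const (allFin k) c) (cong (_* c) (length-tabulate {n = k} id))

  ∑c-const : ∀ m c → ∑c m (λ _ → c) ≡ k ^ m * c
  ∑c-const zero    c = refl
  ∑c-const (suc m) c = begin
    ∑c (suc m) (λ _ → c)                 ≡⟨ ∑c-∷ m _ ⟩
    ∑c m (λ _ → ∑-colours (λ _ → c))     ≡⟨ ∑c-const m _ ⟩
    k ^ m * ∑-colours (λ _ → c)          ≡⟨ cong (k ^ m *_) (∑-colours-const c) ⟩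
    k ^ m * (k * c)                      ≡⟨ sym (*-assoc (k ^ m) k c) ⟩
    k ^ m * k * c                        ≡⟨ cong (_* c) (*-comm (k ^ m) k) ⟩
    k ^ suc m * c                        ∎
    where open ≡-Reasoning

  -- The colourings that begin with `u` contribute some of the terms of a sum of natural numbers.
  -- Together with the analogue for suffixes this allows the fringes to be prescribed.
  ∑c-≥-prefix : ∀ {l} m (u : Vec (Fin k) l) g → ∑c m (λ v → g (u Vec.++ v)) ≤ ∑c (l + m) g
  ∑c-≥-prefix m []      g = ≤-refl
  ∑c-≥-prefix {suc l} m (c ∷ u) g = begin
    ∑c m (λ v → g (c ∷ (u Vec.++ v)))           ≤⟨ ∑c-≥-prefix m u (λ v → g (c ∷ v)) ⟩
    ∑c (l + m) (λ v → g (c ∷ v))                ≤⟨ ∑-mono (allColourings k (l + m)) (λ v → ∈⇒≤∑ (λ d → g (d ∷ v)) (∈-allFin c)) ⟩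
    ∑c (l + m) (λ v → ∑-colours (λ d → g (d ∷ v))) ≡⟨ sym (∑c-∷ (l + m) g) ⟩
    ∑c (suc (l + m)) g                          ∎
    where open ≤-Reasoning

  ∑c-≥-point : ∀ {l} (u : Vec (Fin k) l) g → g u ≤ ∑c l g
  ∑c-≥-point []      g = m≤m+n _ 0
  ∑c-≥-point {suc l} (c ∷ u) g = begin
    g (c ∷ u)                                ≤⟨ ∈⇒≤∑ (λ d → g (d ∷ u)) (∈-allFin c) ⟩
    ∑-colours (λ d → g (d ∷ u))              ≤⟨ ∑c-≥-point u (λ v → ∑-colours (λ d → g (d ∷ v))) ⟩
    ∑c l (λ v → ∑-colours (λ d → g (d ∷ v))) ≡⟨ sym (∑c-∷ l g) ⟩
    ∑c (suc l) g                             ∎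
    where open ≤-Reasoning

  ∑c-≥-suffix : ∀ {l} m (u : Vec (Fin k) l) g → ∑c m (λ v → g (v Vec.++ u)) ≤ ∑c (m + l) g
  ∑c-≥-suffix zero u g = ≤-trans (≤-reflexive (+-identityʳ (g u))) (∑c-≥-point u g)
  ∑c-≥-suffix {l} (suc m) u g = begin
    ∑c (suc m) (λ v → g (v Vec.++ u))                        ≡⟨ ∑c-∷ m _ ⟩
    ∑c m (λ v → ∑-colours (λ c → g (c ∷ (v Vec.++ u))))      ≤⟨ ∑c-≥-suffix m u (λ v → ∑-colours (λ c → g (c ∷ v))) ⟩
    ∑c (m + l) (λ v → ∑-colours (λ c → g (c ∷ v)))           ≡⟨ sym (∑c-∷ (m + l) g) ⟩
    ∑c (suc m + l) g                                         ∎
    where open ≤-Reasoning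

  -- Sums attained by one colour in a colouring

  Has : ∀ {m} → Fin k → Vec (Fin k) m → ℕ → Set
  Has i []      a       = ⊥
  Has i (c ∷ w) zero    = c ≡ i
  Has i (c ∷ w) (suc a) = Has i w a

  Has? : ∀ {m} i (w : Vec (Fin k) m) a → Dec (Has i w a)
  Has? i []      a       = no id
  Has? i (c ∷ w) zero    = c Fin.≟ i
  Has? i (c ∷ w) (suc a) = Has? i w a

  Has⇒< : ∀ {m i} (w : Vec (Fin k) m) {a} → Has i w a → a < m
  Has⇒< (c ∷ w) {zero}  _ = s≤s z≤n
  Has⇒< (c ∷ w) {suc a} q = s≤s (Has⇒< w q)

  Has-∷ʳ⁺ : ∀ {m i} (w : Vec (Fin k) m) {c a} → Has i w a → Has i (w ∷ʳ c) a
  Has-∷ʳ⁺ (d ∷ w) {a = zero}  q = q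
  Has-∷ʳ⁺ (d ∷ w) {a = suc a} q = Has-∷ʳ⁺ w q

  Has-∷ʳ-last : ∀ {m} (w : Vec (Fin k) m) c → Has c (w ∷ʳ c) m
  Has-∷ʳ-last []      c = refl
  Has-∷ʳ-last (d ∷ w) c = Has-∷ʳ-last w c

  Has-∷ʳ⁻ : ∀ {m i} (w : Vec (Fin k) m) {c a} → Has i (w ∷ʳ c) a → Has i w a ⊎ (a ≡ m × c ≡ i)
  Has-∷ʳ⁻ []      {a = zero}  q = inj₂ (refl , q)
  Has-∷ʳ⁻ (d ∷ w) {a = zero}  q = inj₁ q
  Has-∷ʳ⁻ (d ∷ w) {a = suc a} q with Has-∷ʳ⁻ w q
  ... | inj₁ r          = inj₁ r
  ... | inj₂ (refl , e) = inj₂ (refl , e)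

  Has-reverse⁻ : ∀ {m i} (w : Vec (Fin k) m) {a} → Has i (reverse w) a → Has i w (m ∸ suc a)
  Has-reverse⁻ {suc m} {i} (c ∷ w) {a} q with Has-∷ʳ⁻ (reverse w) (subst (λ v → Has i v a) (reverse-∷ c w) q)
  ... | inj₂ (refl , refl) = subst (Has c (c ∷ w)) (sym (n∸n≡0 a)) refl
  ... | inj₁ r = subst (Has i (c ∷ w)) (sym (+-∸-assoc 1 (Has⇒< (reverse w) r))) (Has-reverse⁻ w r)

  -- The sum sought is l ∸ 1, so that nothing meets l = 0.
  Meets : ∀ {m} → Fin k → Vec (Fin k) m → ℕ → Set
  Meets i w l = ∃[ a ] a < l × (Has i w a × Has i w (l ∸ suc a))

  Meets? : ∀ {m} i (w : Vec (Fin k) m) l → Dec (Meets i w l)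
  Meets? i w l = anyUpTo? (λ a → Has? i w a ×-dec Has? i w (l ∸ suc a)) l

  -- Only sums below the length are tested. Larger ones are treated from the other end, through the
  -- reversed colouring.
  unmet : ∀ {m} → Fin k → Vec (Fin k) m → List ℕ
  unmet {m} i w = filter (λ j → ¬? (Meets? i w (suc j))) (upTo m)

  length-unmet : ∀ {m} i (w : Vec (Fin k) m) →
    length (unmet i w) ≡ ∑ (upTo m) (λ j → 𝟙 (¬? (Meets? i w (suc j))))
  length-unmet {m} i w = length-filter-∑ _ (upTo m)

  Meets-∷ʳ⁺ : ∀ {m i} (w : Vec (Fin k) m) {c l} → Meets i w l → Meets i (w ∷ʳ c) l
  Meets-∷ʳ⁺ w (a , a<l , p , q) = a , a<l , Has-∷ʳ⁺ w p , Has-∷ʳ⁺ w q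

  Meets-both⁺ : ∀ {m i} (w : Vec (Fin k) m) {c d l} → Meets i w l → Meets i (c ∷ (w ∷ʳ d)) (suc (suc l))
  Meets-both⁺ {i = i} w {c} {d} {l} (a , a<l , p , q) = suc a , s≤s (m≤n⇒m≤1+n a<l) , Has-∷ʳ⁺ w p ,
    subst (Has i (c ∷ (w ∷ʳ d))) (sym (+-∸-assoc 1 a<l)) (Has-∷ʳ⁺ w q)

  Meets-ends : ∀ {m i} (w : Vec (Fin k) m) → Meets i (i ∷ (w ∷ʳ i)) (suc (suc m))
  Meets-ends w = 0 , s≤s z≤n , refl , Has-∷ʳ-last w _

  -- The expected number of missed sums

  module Expectation (i : Fin k) where

    miss : ∀ {m} → Vec (Fin k) m → ℕ → ℕ
    miss w l = 𝟙 (¬? (Meets? i w l))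

    -- Whether the sum m - 1 is attained depends on the first m colours only, so it is counted on
    -- colourings of length exactly m. There the pairs with this sum are the mirror pairs, which are
    -- disjoint.
    misses : ℕ → ℕ
    misses m = ∑c m (λ w → miss w m)

    total : ℕ → ℕ
    total m = ∑c m (λ w → length (unmet i w))

    misses≤ : ∀ m → misses m ≤ k ^ m
    misses≤ m = ≤-trans (∑-mono (allColourings k m) (λ w → 𝟙≤1 (¬? (Meets? i w m))))
      (≤-reflexive (trans (∑c-const m 1) (*-identityʳ (k ^ m))))

    hits : Fin k → ℕ
    hits c = 𝟙 (c Fin.≟ i)

    1≤∑hits : 1 ≤ ∑-colours hits
    1≤∑hits = ≤-trans (lemma i) (∈⇒≤∑ hits (∈-allFin i))
      where
      lemma : ∀ j → 1 ≤ 𝟙 (j Fin.≟ j)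
      lemma j with j Fin.≟ j
      ... | yes _ = ≤-refl
      ... | no ¬p = ⊥-elim (¬p refl)

    -- If both ends have colour i, they attain the sum themselves and the first term vanishes.
    -- Otherwise the product vanishes, and any pair attaining the sum m - 1 in `w` is shifted by one
    -- place to a pair attaining m + 1.
    miss-peel : ∀ {m} (w : Vec (Fin k) m) c d →
      miss (c ∷ (w ∷ʳ d)) (suc (suc m)) + miss w m * (hits c * hits d) ≤ miss w m
    miss-peel {m} w c d with c Fin.≟ i | d Fin.≟ i
    ... | no _     | _ rewrite *-zeroʳ (miss w m) | +-identityʳ (miss (c ∷ (w ∷ʳ d)) (suc (suc m))) =
      𝟙-mono (¬? (Meets? i (c ∷ (w ∷ʳ d)) (suc (suc m)))) (¬? (Meets? i w m)) (_∘ Meets-both⁺ w)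
    ... | yes _    | no _ rewrite *-zeroʳ (miss w m) | +-identityʳ (miss (c ∷ (w ∷ʳ d)) (suc (suc m))) =
      𝟙-mono (¬? (Meets? i (c ∷ (w ∷ʳ d)) (suc (suc m)))) (¬? (Meets? i w m)) (_∘ Meets-both⁺ w)
    ... | yes refl | yes refl = ≤-reflexive (cong₂ _+_ (zero′ (Meets? i (i ∷ (w ∷ʳ i)) (suc (suc m))) (Meets-ends w)) (*-identityʳ (miss w m)))
      where
      zero′ : ∀ {A : Set} (A? : Dec A) → A → 𝟙 (¬? A?) ≡ 0
      zero′ (yes _) _ = refl
      zero′ (no ¬a) a = ⊥-elim (¬a a)

    -- Peeling off both ends of a colouring: the pair of ends alone succeeds with probability 1 / k².
    misses-peel : ∀ m → misses (suc (suc m)) + misses m ≤ k * k * misses m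
    misses-peel m = begin
      misses (suc (suc m)) + misses m
        ≡⟨ cong (_+ misses m) (trans (∑c-∷ (suc m) (λ w → miss w (suc (suc m)))) (∑c-∷ʳ m _)) ⟩
      ∑c m (λ w → ∑-colours (λ d → ∑-colours (λ c → miss (c ∷ (w ∷ʳ d)) (suc (suc m))))) + misses m
        ≡⟨ sym (∑-distrib-+ (allColourings k m) _ _) ⟩
      ∑c m (λ w → ∑-colours (λ d → ∑-colours (λ c → miss (c ∷ (w ∷ʳ d)) (suc (suc m)))) + miss w m)
        ≤⟨ ∑-mono (allColourings k m) bound ⟩
      ∑c m (λ w → k * k * miss w m)
        ≡⟨ ∑-distribˡ-* (allColourings k m) (k * k) _ ⟩
      k * k * misses m ∎
      where
      open ≤-Reasoning
      -- The pair of ends coloured (i, i) already contributes x.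
      ∑∑hits : ∀ x → x ≤ ∑-colours (λ d → ∑-colours (λ c → x * (hits c * hits d)))
      ∑∑hits x = begin
        x                                                          ≡⟨ sym (*-identityʳ x) ⟩
        x * (1 * 1)                                                ≤⟨ *-monoʳ-≤ x (*-mono-≤ 1≤∑hits 1≤∑hits) ⟩
        x * (∑-colours hits * ∑-colours hits)                      ≡⟨ cong (x *_) (sym (∑-distribˡ-* (allFin k) (∑-colours hits) hits)) ⟩
        x * ∑-colours (λ d → ∑-colours hits * hits d)              ≡⟨ sym (∑-distribˡ-* (allFin k) x _) ⟩
        ∑-colours (λ d → x * (∑-colours hits * hits d))            ≡⟨ ∑-cong (allFin k) (λ d → cong (x *_) (trans (*-comm (∑-colours hits) (hits d)) (sym (∑-distribˡ-* (allFin k) (hits d) hits)))) ⟩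
        ∑-colours (λ d → x * ∑-colours (λ c → hits d * hits c))    ≡⟨ ∑-cong (allFin k) (λ d → trans (sym (∑-distribˡ-* (allFin k) x _)) (∑-cong (allFin k) (λ c → cong (x *_) (*-comm (hits d) (hits c))))) ⟩
        ∑-colours (λ d → ∑-colours (λ c → x * (hits c * hits d)))  ∎
      bound : ∀ w → ∑-colours (λ d → ∑-colours (λ c → miss (c ∷ (w ∷ʳ d)) (suc (suc m)))) + miss w m ≤ k * k * miss w m
      bound w = begin
        ∑-colours (λ d → ∑-colours (λ c → miss (c ∷ (w ∷ʳ d)) (suc (suc m)))) + miss w m
          ≤⟨ +-monoʳ-≤ _ (∑∑hits (miss w m)) ⟩
        ∑-colours (λ d → ∑-colours (λ c → miss (c ∷ (w ∷ʳ d)) (suc (suc m)))) + ∑-colours (λ d → ∑-colours (λ c → miss w m * (hits c * hits d)))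
          ≡⟨ sym (trans (∑-cong (allFin k) (λ d → ∑-distrib-+ (allFin k) _ _)) (∑-distrib-+ (allFin k) _ _)) ⟩
        ∑-colours (λ d → ∑-colours (λ c → miss (c ∷ (w ∷ʳ d)) (suc (suc m)) + miss w m * (hits c * hits d)))
          ≤⟨ ∑-mono (allFin k) (λ d → ∑-mono (allFin k) (λ c → miss-peel w c d)) ⟩
        ∑-colours (λ d → ∑-colours (λ c → miss w m))
          ≡⟨ trans (∑-colours-const _) (cong (k *_) (∑-colours-const (miss w m))) ⟩
        k * (k * miss w m)
          ≡⟨ sym (*-assoc k k _) ⟩
        k * k * miss w m ∎

    -- Appending a colour keeps every attained sum attained and adds a single new sum to the test,
    -- namely m.
    total-∷ʳ : ∀ m → total (suc m) ≤ k * total m + misses (suc m)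
    total-∷ʳ m = begin
      total (suc m)
        ≡⟨ ∑-cong (allColourings k (suc m)) split ⟩
      ∑c (suc m) (λ w → ∑ (upTo m) (λ j → miss w (suc j)) + miss w (suc m))
        ≡⟨ ∑-distrib-+ (allColourings k (suc m)) _ _ ⟩
      ∑c (suc m) (λ w → ∑ (upTo m) (λ j → miss w (suc j))) + misses (suc m)
        ≡⟨ cong (_+ misses (suc m)) (∑c-∷ʳ m _) ⟩
      ∑c m (λ w → ∑-colours (λ c → ∑ (upTo m) (λ j → miss (w ∷ʳ c) (suc j)))) + misses (suc m)
        ≤⟨ +-monoˡ-≤ (misses (suc m)) (∑-mono (allColourings k m) (λ w → ∑-mono (allFin k) (λ c →
             ∑-mono (upTo m) (λ j → 𝟙-mono (¬? (Meets? i (w ∷ʳ c) (suc j))) (¬? (Meets? i w (suc j))) (_∘ Meets-∷ʳ⁺ w))))) ⟩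
      ∑c m (λ w → ∑-colours (λ c → ∑ (upTo m) (λ j → miss w (suc j)))) + misses (suc m)
        ≡⟨ cong (_+ misses (suc m)) (∑-cong (allColourings k m) (λ w → trans (∑-colours-const _) (cong (k *_) (sym (length-unmet i w))))) ⟩
      ∑c m (λ w → k * length (unmet i w)) + misses (suc m)
        ≡⟨ cong (_+ misses (suc m)) (∑-distribˡ-* (allColourings k m) k _) ⟩
      k * total m + misses (suc m) ∎
      where
      open ≤-Reasoning
      split : (w : Vec (Fin k) (suc m)) → length (unmet i w) ≡ ∑ (upTo m) (λ j → miss w (suc j)) + miss w (suc m)
      split w = trans (length-unmet i w)
        (trans (cong (λ xs → ∑ xs (λ j → miss w (suc j))) (sym (upTo-∷ʳ m)))
        (trans (cong sum (map-++ (λ j → miss w (suc j)) (upTo m) (m ∷ [])))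
        (trans (sum-++ (map (λ j → miss w (suc j)) (upTo m)) _)
        (cong (∑ (upTo m) (λ j → miss w (suc j)) ℕ.+_) (+-identityʳ _)))))

    -- With e l = misses l / k ^ l, misses-peel reads e l ≤ k² (e l − e (l + 2)), so the sum of the e l telescopes.
    total-telescoped : ∀ m → total m + (k * misses (suc m) + misses (suc (suc m))) ≤ 2 * (k * k) * k ^ m
    total-telescoped zero = begin
      total 0 + (k * misses 1 + misses 2) ≤⟨ +-monoʳ-≤ 0 (+-mono-≤ (*-monoʳ-≤ k (misses≤ 1)) (misses≤ 2)) ⟩
      k * k ^ 1 + k ^ 2                   ≡⟨ solve 1 (λ k → k :* (k :* con 1) :+ k :* (k :* con 1) := con 2 :* (k :* k) :* con 1) refl k ⟩
      2 * (k * k) * k ^ 0                 ∎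
      where
      open ≤-Reasoning
      open +-*-Solver
    total-telescoped (suc m) = begin
      total (suc m) + (k * F₂ + misses (suc (suc (suc m))))
        ≤⟨ +-monoˡ-≤ _ (total-∷ʳ m) ⟩
      k * total m + F₁ + (k * F₂ + misses (suc (suc (suc m))))
        ≡⟨ solve 4 (λ a b c d → a :+ b :+ (c :+ d) := a :+ c :+ (d :+ b)) refl (k * total m) F₁ (k * F₂) (misses (suc (suc (suc m)))) ⟩
      k * total m + k * F₂ + (misses (suc (suc (suc m))) + F₁)
        ≤⟨ +-monoʳ-≤ (k * total m + k * F₂) (misses-peel (suc m)) ⟩
      k * total m + k * F₂ + k * k * F₁
        ≡⟨ solve 4 (λ k t a b → k :* t :+ k :* b :+ k :* k :* a := k :* (t :+ (k :* a :+ b))) refl k (total m) F₁ F₂ ⟩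
      k * (total m + (k * F₁ + F₂))
        ≤⟨ *-monoʳ-≤ k (total-telescoped m) ⟩
      k * (2 * (k * k) * k ^ m)
        ≡⟨ solve 2 (λ k e → k :* (con 2 :* (k :* k) :* e) := con 2 :* (k :* k) :* (k :* e)) refl k (k ^ m) ⟩
      2 * (k * k) * k ^ suc m ∎
      where
      open ≤-Reasoning
      open +-*-Solver
      F₁ = misses (suc m)
      F₂ = misses (suc (suc m))

    total≤ : ∀ m → total m ≤ 2 * (k * k) * k ^ m
    total≤ m = ≤-trans (m≤m+n _ _) (total-telescoped m)

  -- Colourings that are good for all classes at once

  defect : ∀ {m} → Vec (Fin k) m → ℕ
  defect w = ∑-colours (λ i → length (unmet i w) + length (unmet i (reverse w)))

  -- For each of the k classes, twice the bound 2k² of `total≤`: once for the colouring and once for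
  -- its reverse.
  defect-bound : ℕ
  defect-bound = k * (4 * (k * k))

  ∑defect≤ : ∀ m → ∑c m defect ≤ defect-bound * k ^ m
  ∑defect≤ m = begin
    ∑c m defect
      ≡⟨ ∑-swap (allColourings k m) (allFin k) (λ w i → length (unmet i w) + length (unmet i (reverse w))) ⟩
    ∑-colours (λ i → ∑c m (λ w → length (unmet i w) + length (unmet i (reverse w))))
      ≤⟨ ∑-mono (allFin k) each ⟩
    ∑-colours (λ _ → 4 * (k * k) * k ^ m)
      ≡⟨ ∑-colours-const _ ⟩
    k * (4 * (k * k) * k ^ m)
      ≡⟨ sym (*-assoc k (4 * (k * k)) (k ^ m)) ⟩
    defect-bound * k ^ m ∎
    where
    open ≤-Reasoning
    open +-*-Solver
    each : ∀ i → ∑c m (λ w → length (unmet i w) + length (unmet i (reverse w))) ≤ 4 * (k * k) * k ^ m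
    each i = begin
      ∑c m (λ w → length (unmet i w) + length (unmet i (reverse w)))
        ≡⟨ ∑-distrib-+ (allColourings k m) _ _ ⟩
      total m + ∑c m (λ w → length (unmet i (reverse w)))
        ≡⟨ cong (total m ℕ.+_) (∑c-reverse m (λ w → length (unmet i w))) ⟩
      total m + total m
        ≤⟨ +-mono-≤ (total≤ m) (total≤ m) ⟩
      2 * (k * k) * k ^ m + 2 * (k * k) * k ^ m
        ≡⟨ solve 2 (λ k e → con 2 :* (k :* k) :* e :+ con 2 :* (k :* k) :* e := con 4 :* (k :* k) :* e) refl k (k ^ m) ⟩
      4 * (k * k) * k ^ m ∎
      where open Expectation i

  -- Markov's inequality for a natural number with mean at most K = `defect-bound`: exceeding K
  -- means being at least K + 1, so a proportion of at least 1 / (K + 1) does not exceed K. The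
  -- defect sums over all classes, so one threshold serves every class and no union bound is taken.
  defect-markov : ∀ m {p} {P : Vec (Fin k) m → Set p} (P? : ∀ w → Dec (P w)) →
    (∀ w → defect w ≤ defect-bound → P w) →
    k ^ m ≤ suc defect-bound * ∑c m (𝟙 ∘ P?)
  defect-markov m P? good = +-cancelʳ-≤ (K * k ^ m) (k ^ m) _ (begin
    suc K * k ^ m                              ≡⟨ *-comm (suc K) (k ^ m) ⟩
    k ^ m * suc K                              ≡⟨ sym (∑c-const m (suc K)) ⟩
    ∑c m (λ _ → suc K)                         ≤⟨ ∑-mono (allColourings k m) (λ w → pointwise w (P? w)) ⟩
    ∑c m (λ w → suc K * 𝟙 (P? w) + defect w)   ≡⟨ ∑-distrib-+ (allColourings k m) _ _ ⟩
    ∑c m (λ w → suc K * 𝟙 (P? w)) + ∑c m defect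
                                               ≡⟨ cong (_+ ∑c m defect) (∑-distribˡ-* (allColourings k m) (suc K) _) ⟩
    suc K * ∑c m (𝟙 ∘ P?) + ∑c m defect        ≤⟨ +-monoʳ-≤ (suc K * ∑c m (𝟙 ∘ P?)) (∑defect≤ m) ⟩
    suc K * ∑c m (𝟙 ∘ P?) + K * k ^ m          ∎)
    where
    open ≤-Reasoning
    K = defect-bound
    pointwise : ∀ w (d : Dec _) → suc K ≤ suc K * 𝟙 d + defect w
    pointwise w (yes _) = ≤-trans (≤-reflexive (sym (*-identityʳ (suc K)))) (m≤m+n (suc K * 1) (defect w))
    pointwise w (no ¬p) = ≤-trans (≰⇒> (¬p ∘ good w)) (m≤n+m (defect w) (suc K * 0))

-- The periodic fringes

rotate : ∀ {k} → Fin (suc k) → Fin (suc k)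
rotate Fin.zero    = Fin.fromℕ _
rotate (Fin.suc i) = Fin.inject₁ i

-- The cyclic shift is free of fixed points as soon as there are two colours; this is where k ≥ 2
-- enters.
rotate-derangement : ∀ {k} (i : Fin (suc (suc k))) → rotate i ≢ i
rotate-derangement Fin.zero    ()
rotate-derangement (Fin.suc i) eq = 1+n≢n (trans (cong toℕ (sym eq)) (toℕ-inject₁ i))

rotate-surjective : ∀ {k} (i : Fin (suc k)) → ∃[ j ] rotate j ≡ i
rotate-surjective i with view i
... | ‵fromℕ     = Fin.zero , refl
... | ‵inject₁ j = Fin.suc j , refl

module _ {d} .{{_ : NonZero d}} where

  [r+q*d]%d≡r : ∀ {r} q → r < d → (r + q * d) % d ≡ r
  [r+q*d]%d≡r {r} q r<d = trans ([m+kn]%n≡m%n r q d) (m<n⇒m%n≡m r<d)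

  [r+q*d]/d≡q : ∀ {r} q → r < d → (r + q * d) / d ≡ q
  [r+q*d]/d≡q {r} q r<d = trans (+-distrib-/-∣ʳ r (n∣m*n q)) (cong₂ _+_ (m<n⇒m/n≡0 r<d) (m*n/n≡m q d))

  -- When x + z ≡ -1, the remainders add up to d - 1 without a carry, so both digits are
  -- complemented. Used in base M and then in base 10, this splits a pair of opposite positions into
  -- facing offsets and facing blocks.
  divMod-complement : ∀ {x z} c → suc (x + z) ≡ c * d →
    suc (x / d + z / d) ≡ c × suc (x % d + z % d) ≡ d
  divMod-complement {x} {z} c eq =
    trans (cong (λ t → suc (x / d + t)) z/d) (m+[n∸m]≡n q<c) ,
    trans (cong (λ t → suc (x % d + t)) z%d) (m+[n∸m]≡n r<d)
    where
    open +-*-Solver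
    q = x / d
    r = x % d
    r<d : r < d
    r<d = m%n<n x d
    q<c : q < c
    q<c = m<n*o⇒m/o<n (≤-trans (s≤s (m≤m+n x z)) (≤-reflexive eq))
    z≡ : z ≡ (d ∸ suc r) + (c ∸ suc q) * d
    z≡ = +-cancelˡ-≡ (suc x) z _ (begin
      suc x + z
        ≡⟨ eq ⟩
      c * d
        ≡⟨ cong (_* d) (sym (m+[n∸m]≡n q<c)) ⟩
      (suc q + (c ∸ suc q)) * d
        ≡⟨ *-distribʳ-+ d (suc q) (c ∸ suc q) ⟩
      (d + q * d) + (c ∸ suc q) * d
        ≡⟨ cong (λ t → (t + q * d) + (c ∸ suc q) * d) (sym (m+[n∸m]≡n r<d)) ⟩
      ((suc r + (d ∸ suc r)) + q * d) + (c ∸ suc q) * d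
        ≡⟨ solve 4 (λ r t u v → ((con 1 :+ r :+ t) :+ u) :+ v := (con 1 :+ (r :+ u)) :+ (t :+ v)) refl r (d ∸ suc r) (q * d) ((c ∸ suc q) * d) ⟩
      suc (r + q * d) + ((d ∸ suc r) + (c ∸ suc q) * d)
        ≡⟨ cong (λ t → suc t + ((d ∸ suc r) + (c ∸ suc q) * d)) (sym (m≡m%n+[m/n]*n x d)) ⟩
      suc x + ((d ∸ suc r) + (c ∸ suc q) * d) ∎)
      where open ≡-Reasoning
    co<d : d ∸ suc r < d
    co<d = ∸-monoʳ-< (s≤s z≤n) r<d
    z/d : z / d ≡ c ∸ suc q
    z/d = trans (cong (_/ d) z≡) ([r+q*d]/d≡q (c ∸ suc q) co<d)
    z%d : z % d ≡ d ∸ suc r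
    z%d = trans (cong (_% d) z≡) ([r+q*d]%d≡r (c ∸ suc q) co<d)

complementˡ : ∀ a b {t} → suc (a + b) ≡ t → t ∸ suc a ≡ b
complementˡ a b refl = m+n∸m≡n a b

complementʳ : ∀ a b {t} → suc (a + b) ≡ t → t ∸ suc b ≡ a
complementʳ a b refl = m+n∸n≡m a b

split-sum : ∀ m {t} → t ≤ m + m → ∃[ a ] ∃[ b ] a + b ≡ t × a ≤ m × b ≤ m
split-sum m {t} t≤m+m with ≤-total t m
... | inj₁ t≤m = t , 0 , +-identityʳ t , t≤m , z≤n
... | inj₂ m≤t = m , t ∸ m , m+[n∸m]≡n m≤t , ≤-refl , ≤-trans (∸-monoˡ-≤ m t≤m+m) (≤-reflexive (m+n∸n≡m m m))

data Kind : Set where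
  first row column last : Kind

-- A period consists of ten blocks: the first takes the prefix, and the last has to avoid the mirrored suffix.
-- Ten is the least number for which the others can be split into rows and columns
-- with rows + columns everything modulo the number of blocks.
kind : ℕ → Kind
kind 0 = first
kind 1 = row
kind 2 = row
kind 3 = column
kind 4 = column
kind 5 = row
kind 6 = column
kind 7 = column
kind 8 = column
kind _ = last

-- The bounds make the positions built from these blocks `Inner`, so that they can be mirrored. The
-- alternative `10 + q` is a carry into the next period.
record RowColumn (q : ℕ) : Set where
  constructor rowColumn
  field
    r c    : ℕ
    isRow  : kind r ≡ row
    isCol  : kind c ≡ column
    r<9    : r < 9
    c<9    : c < 9
    r+c≡q  : r + c ≡ q ⊎ r + c ≡ 10 + q

rows+columns : (q : Fin 10) → RowColumn (toℕ q)
rows+columns 0F = rowColumn 2 8 refl refl (<ᵇ⇒< _ _ _) (<ᵇ⇒< _ _ _) (inj₂ refl)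
rows+columns 1F = rowColumn 5 6 refl refl (<ᵇ⇒< _ _ _) (<ᵇ⇒< _ _ _) (inj₂ refl)
rows+columns 2F = rowColumn 5 7 refl refl (<ᵇ⇒< _ _ _) (<ᵇ⇒< _ _ _) (inj₂ refl)
rows+columns 3F = rowColumn 5 8 refl refl (<ᵇ⇒< _ _ _) (<ᵇ⇒< _ _ _) (inj₂ refl)
rows+columns 4F = rowColumn 1 3 refl refl (<ᵇ⇒< _ _ _) (<ᵇ⇒< _ _ _) (inj₁ refl)
rows+columns 5F = rowColumn 1 4 refl refl (<ᵇ⇒< _ _ _) (<ᵇ⇒< _ _ _) (inj₁ refl)
rows+columns 6F = rowColumn 2 4 refl refl (<ᵇ⇒< _ _ _) (<ᵇ⇒< _ _ _) (inj₁ refl)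
rows+columns 7F = rowColumn 1 6 refl refl (<ᵇ⇒< _ _ _) (<ᵇ⇒< _ _ _) (inj₁ refl)
rows+columns 8F = rowColumn 1 7 refl refl (<ᵇ⇒< _ _ _) (<ᵇ⇒< _ _ _) (inj₁ refl)
rows+columns 9F = rowColumn 1 8 refl refl (<ᵇ⇒< _ _ _) (<ᵇ⇒< _ _ _) (inj₁ refl)

record Sum (Q : ℕ → Set) (s : ℕ) : Set where
  constructor _⊹_by_
  field
    {x y} : ℕ
    Qx    : Q x
    Qy    : Q y
    x+y≡s : x + y ≡ s

Zone : ∀ {k} → (ℕ → Fin k) → ℕ → Fin k → ℕ → Set
Zone c T i x = x < T × c x ≡ i

-- The two mirrored patterns and their sums

module Pattern (k h : ℕ) .{{_ : NonZero k}} .{{_ : NonZero h}} (k≤h : k ≤ h)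
  (σ : Fin k → Fin k) (σ-derangement : ∀ i → σ i ≢ i) (σ-surjective : ∀ i → ∃[ j ] σ j ≡ i)
  (prefix suffix : ℕ → Fin k) where

  M : ℕ
  M = k * h

  instance
    M≢0 : NonZero M
    M≢0 = m*n≢0 k h

  leftAt : ℕ → ℕ → Fin k
  leftAt b o with kind b
  ... | first  = prefix o
  ... | row    = o mod k
  ... | column = (o / h) mod k
  ... | last   = σ (suffix (M ∸ suc o))

  rightAt : ℕ → ℕ → Fin k
  rightAt zero    o = suffix o
  -- Right block b + 1 faces left block 9 - (b + 1) = 8 - b, and offset o faces M - 1 - o.
  rightAt (suc b) o = σ (leftAt (8 ∸ b) (M ∸ suc o))

  left right : ℕ → Fin k
  left  x = leftAt  ((x / M) % 10) (x % M)
  right z = rightAt ((z / M) % 10) (z % M)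

  -- Opposite to these blocks the right colour is σ of the left one. For left block 9 the dependence
  -- is reversed, since it faces the suffix, so its positions cannot be carried over to the right.
  Inner : ℕ → Set
  Inner x = (x / M) % 10 < 9

  opposite-coords : ∀ {x z} c → suc (x + z) ≡ c * (10 * M) →
    suc ((x / M) % 10 + (z / M) % 10) ≡ 10 × suc (x % M + z % M) ≡ M
  opposite-coords {x} {z} c eq with divMod-complement {M} (c * 10) (trans eq (sym (*-assoc c 10 M)))
  ... | blocks , offsets = proj₂ (divMod-complement {10} {x / M} {z / M} c blocks) , offsets

  mirrored : ∀ b b″ o o′ → suc (b + suc b″) ≡ 10 → suc (o + o′) ≡ M → rightAt (suc b″) o′ ≡ σ (leftAt b o)
  mirrored b b″ o o′ eqb eqo = cong σ (cong₂ leftAt (complementʳ b (suc b″) eqb) (complementʳ o o′ eqo))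

  -- Of two opposite colours one is always σ of the other: the left one if the right position is in
  -- block 0, the right one otherwise.
  opposite⇒≢ : ∀ {x z} c → suc (x + z) ≡ c * (10 * M) → left x ≢ right z
  opposite⇒≢ {x} {z} c eq with opposite-coords {x} {z} c eq
  ... | blocks , offsets = at ((x / M) % 10) ((z / M) % 10) (x % M) (z % M) blocks offsets
    where
    at : ∀ b b′ o o′ → suc (b + b′) ≡ 10 → suc (o + o′) ≡ M → leftAt b o ≢ rightAt b′ o′
    at b zero o o′ eqb eqo e = σ-derangement (suffix o′) (begin
      σ (suffix o′)             ≡⟨ cong (σ ∘ suffix) (sym (complementˡ o o′ eqo)) ⟩
      leftAt 9 o                ≡⟨ cong (λ t → leftAt t o) (trans (sym (suc-injective eqb)) (+-identityʳ b)) ⟩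
      leftAt b o                ≡⟨ e ⟩
      suffix o′                 ∎)
      where open ≡-Reasoning
    at b (suc b″) o o′ eqb eqo e = σ-derangement (leftAt b o) (trans (sym (mirrored b b″ o o′ eqb eqo)) (sym e))

  opposite-inner : ∀ {x z} c → suc (x + z) ≡ c * (10 * M) → Inner x → right z ≡ σ (left x)
  opposite-inner {x} {z} c eq inner with opposite-coords {x} {z} c eq
  ... | blocks , offsets = at ((x / M) % 10) ((z / M) % 10) (x % M) (z % M) blocks offsets inner
    where
    at : ∀ b b′ o o′ → suc (b + b′) ≡ 10 → suc (o + o′) ≡ M → b < 9 → rightAt b′ o′ ≡ σ (leftAt b o)
    at b zero o o′ eqb eqo b<9 = contradiction b<9 (<-irrefl (trans (sym (+-identityʳ b)) (suc-injective eqb)))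
    at b (suc b″) o o′ eqb eqo b<9 = mirrored b b″ o o′ eqb eqo

  left-prefix : ∀ {x} → x < M → left x ≡ prefix x
  left-prefix x<M = cong₂ leftAt (cong (_% 10) (m<n⇒m/n≡0 {n = M} x<M)) (m<n⇒m%n≡m x<M)

  right-suffix : ∀ {z} → z < M → right z ≡ suffix z
  right-suffix z<M = cong₂ rightAt (cong (_% 10) (m<n⇒m/n≡0 {n = M} z<M)) (m<n⇒m%n≡m z<M)

  leftAt-row : ∀ {b o} → kind b ≡ row → leftAt b o ≡ o mod k
  leftAt-row {b} eq with kind b
  leftAt-row refl | .row = refl

  leftAt-column : ∀ {b o} → kind b ≡ column → leftAt b o ≡ (o / h) mod k
  leftAt-column {b} eq with kind b
  leftAt-column refl | .column = refl

  mod-toℕ : ∀ (i : Fin k) {t} → t % k ≡ toℕ i → t mod k ≡ i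
  mod-toℕ i {t} eq = toℕ-injective (trans (toℕ-fromℕ< (m%n<n t k)) eq)

  position : ∀ {a b o} → b < 9 → o < M →
    let x = o + (b + a * 10) * M in left x ≡ leftAt b o × Inner x
  position {a} {b} {o} b<9 o<M = cong₂ leftAt block offset , subst (_< 9) (sym block) b<9
    where
    offset = [r+q*d]%d≡r {M} (b + a * 10) o<M
    block : ((o + (b + a * 10) * M) / M) % 10 ≡ b
    block = trans (cong (_% 10) ([r+q*d]/d≡q {M} (b + a * 10) o<M)) ([r+q*d]%d≡r {10} a (m≤n⇒m≤1+n b<9))

  position< : ∀ {a b o R} → b < 9 → o < M → a ≤ R → o + (b + a * 10) * M < suc R * (10 * M)
  position< {a} {b} {o} {R} b<9 o<M a≤R = begin-strict
    o + (b + a * 10) * M      <⟨ +-monoˡ-< _ o<M ⟩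
    suc (b + a * 10) * M      ≤⟨ *-monoˡ-≤ M (+-mono-≤ (m≤n⇒m≤1+n b<9) (*-monoˡ-≤ 10 a≤R)) ⟩
    (10 + R * 10) * M         ≡⟨ solve 2 (λ R M → (con 10 :+ R :* con 10) :* M := (con 1 :+ R) :* (con 10 :* M)) refl R M ⟩
    suc R * (10 * M)          ∎
    where
    open ≤-Reasoning
    open +-*-Solver

  record Decomposition (T : ℕ) (i : Fin k) (s : ℕ) : Set where
    constructor decomposition
    field
      x y     : ℕ
      x+y≡s   : x + y ≡ s
      x<T     : x < T
      y<T     : y < T
      left-x  : left x ≡ i
      left-y  : left y ≡ i
      inner-x : Inner x
      inner-y : Inner y

  -- In a row block colour i occupies i + k l (l < h), in a column block i h + e (e < h);
  -- as k ≤ h these add up to k h consecutive integers, that is to a translate of a block.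
  left-sums : ∀ R i s → 2 * (10 * M) ≤ s → s + 10 * M < 2 * (suc R * (10 * M)) →
    Decomposition (suc R * (10 * M)) i s
  left-sums R i s lo hi = decomposed
    where
    open +-*-Solver
    ι = toℕ i
    ι<k = toℕ<n i
    -- The least sum of a row offset and a column offset of colour i. Beyond it the pair (l, e)
    -- contributes l k + e, and division of `off` by k yields l < h and e < k ≤ h.
    base = ι + ι * h
    base≤M : base ≤ M
    base≤M = ≤-trans (+-monoˡ-≤ (ι * h) (≤-trans (<⇒≤ ι<k) k≤h)) (*-monoˡ-≤ h ι<k)
    M≤10M : M ≤ 10 * M
    M≤10M = m≤n*m M 10
    s′ = s ∸ base
    10M≤s′ : 10 * M ≤ s′
    10M≤s′ = ≤-trans (≤-reflexive (sym (m+n∸n≡m (10 * M) (10 * M))))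
      (∸-mono (≤-trans (≤-reflexive (cong (10 * M ℕ.+_) (sym (+-identityʳ (10 * M))))) lo) (≤-trans base≤M M≤10M))
    base≤s : base ≤ s
    base≤s = ≤-trans base≤M (≤-trans M≤10M (≤-trans (m≤m+n (10 * M) _) lo))
    block = s′ / M
    off = s′ % M
    l = off / k
    e = off % k
    Q = block / 10
    l<h : l < h
    l<h = m<n*o⇒m/o<n (subst (off <_) (*-comm k h) (m%n<n s′ M))
    e<h : e < h
    e<h = <-≤-trans (m%n<n off k) k≤h
    row<M : ι + l * k < M
    row<M = <-≤-trans (+-monoˡ-< (l * k) ι<k) (≤-trans (*-monoˡ-≤ k l<h) (≤-reflexive (*-comm h k)))
    col<M : e + ι * h < M
    col<M = <-≤-trans (+-monoˡ-< (ι * h) e<h) (*-monoˡ-≤ h ι<k)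
    off≡ : off ≡ e + l * k
    off≡ = m≡m%n+[m/n]*n off k
    s′≡ : s′ ≡ off + block * M
    s′≡ = m≡m%n+[m/n]*n s′ M
    block≡ : block ≡ block % 10 + Q * 10
    block≡ = m≡m%n+[m/n]*n block 10
    1≤Q : 1 ≤ Q
    1≤Q = m≥n⇒m/n>0 (≤-trans (≤-reflexive (sym (m*n/n≡m 10 M))) (/-monoˡ-≤ M 10M≤s′))
    -- The period left free at the top gives this bound, which lets the periods be shared between
    -- two summands with index at most R each.
    Q≤2R : Q ≤ R + R
    Q≤2R = ≤-pred (≤-pred (*-cancelʳ-< (10 * M) (suc Q) (suc (suc (R + R))) (begin-strict
      10 * M + Q * (10 * M)        ≡⟨ cong (10 * M ℕ.+_) (sym (*-assoc Q 10 M)) ⟩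
      10 * M + Q * 10 * M          ≤⟨ +-monoʳ-≤ (10 * M) (*-monoˡ-≤ M (m/n*n≤m block 10)) ⟩
      10 * M + block * M           ≤⟨ +-monoʳ-≤ (10 * M) (m/n*n≤m s′ M) ⟩
      10 * M + s′                  ≤⟨ +-monoʳ-≤ (10 * M) (m∸n≤m s base) ⟩
      10 * M + s                   ≡⟨ +-comm (10 * M) s ⟩
      s + 10 * M                   <⟨ hi ⟩
      2 * (suc R * (10 * M))       ≡⟨ solve 2 (λ R p → con 2 :* ((con 1 :+ R) :* p) := (con 2 :+ (R :+ R)) :* p) refl R (10 * M) ⟩
      suc (suc (R + R)) * (10 * M) ∎)))
      where open ≤-Reasoning
    open RowColumn (rows+columns (block mod 10))
    q≡ : toℕ (block mod 10) ≡ block % 10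
    q≡ = toℕ-fromℕ< (m%n<n block 10)
    -- If r + c overshoots by 10, one period is taken back from Q. This needs Q ≥ 1, which is why
    -- `s` starts at two periods while `base` uses up at most one.
    carry : ∃[ Q′ ] r + c + Q′ * 10 ≡ block × Q′ ≤ R + R
    carry with r+c≡q
    ... | inj₁ eq = Q , trans (cong (_+ Q * 10) (trans eq q≡)) (sym block≡) , Q≤2R
    ... | inj₂ eq = ℕ.pred Q , (begin
        r + c + ℕ.pred Q * 10               ≡⟨ cong (_+ ℕ.pred Q * 10) (trans eq (cong (10 ℕ.+_) q≡)) ⟩
        10 + block % 10 + ℕ.pred Q * 10     ≡⟨ solve 2 (λ b q → con 10 :+ b :+ q :* con 10 := b :+ (con 1 :+ q) :* con 10) refl (block % 10) (ℕ.pred Q) ⟩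
        block % 10 + suc (ℕ.pred Q) * 10    ≡⟨ cong (λ t → block % 10 + t * 10) (suc-pred Q {{ℕ.>-nonZero 1≤Q}}) ⟩
        block % 10 + Q * 10                 ≡⟨ sym block≡ ⟩
        block ∎) , ≤-trans pred[n]≤n Q≤2R
      where open ≡-Reasoning
    decomposed : Decomposition (suc R * (10 * M)) i s
    decomposed with carry
    ... | Q′ , blocks , Q′≤2R with split-sum R Q′≤2R
    ... | a , b , a+b≡Q′ , a≤R , b≤R = decomposition
      ((ι + l * k) + (r + a * 10) * M) ((e + ι * h) + (c + b * 10) * M) sums
      (position< {a} r<9 row<M a≤R) (position< {b} c<9 col<M b≤R)
      (trans (proj₁ (position {a} r<9 row<M)) (trans (leftAt-row {r} isRow) (mod-toℕ i ([r+q*d]%d≡r {k} l ι<k))))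
      (trans (proj₁ (position {b} c<9 col<M)) (trans (leftAt-column {c} isCol)
        (mod-toℕ i (trans (cong (_% k) ([r+q*d]/d≡q {h} ι e<h)) (m<n⇒m%n≡m ι<k)))))
      (proj₂ (position {a} r<9 row<M)) (proj₂ (position {b} c<9 col<M))
      where
      open ≡-Reasoning
      sums : ((ι + l * k) + (r + a * 10) * M) + ((e + ι * h) + (c + b * 10) * M) ≡ s
      sums = begin
        ((ι + l * k) + (r + a * 10) * M) + ((e + ι * h) + (c + b * 10) * M)
          ≡⟨ solve 9 (λ ι lk e ιh r a c b M → ((ι :+ lk) :+ (r :+ a :* con 10) :* M) :+ ((e :+ ιh) :+ (c :+ b :* con 10) :* M)
                := (ι :+ ιh) :+ ((e :+ lk) :+ (r :+ c :+ (a :+ b) :* con 10) :* M)) refl ι (l * k) e (ι * h) r a c b M ⟩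
        base + ((e + l * k) + (r + c + (a + b) * 10) * M)
          ≡⟨ cong₂ (λ u v → base + (u + (r + c + v * 10) * M)) (sym off≡) a+b≡Q′ ⟩
        base + (off + (r + c + Q′ * 10) * M)
          ≡⟨ cong (λ u → base + (off + u * M)) blocks ⟩
        base + (off + block * M)
          ≡⟨ cong (base ℕ.+_) (sym s′≡) ⟩
        base + s′
          ≡⟨ m+[n∸m]≡n base≤s ⟩
        s ∎

  -- A weaker form of `left-sums` with a window that also suits the right end; the 2 in the upper
  -- bound comes from the reflection s ↦ 2T - 2 - s used there.
  left-zone-sums : ∀ R i s → let p = 10 * M; T = suc R * p in
    p + p ≤ s → s + (2 + (p + p)) ≤ T + T → Sum (Zone left T i) s
  left-zone-sums R i s lo hi = (x<T , left-x) ⊹ (y<T , left-y) by x+y≡s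
    where
    p = 10 * M
    double : ∀ t → t + t ≡ 2 * t
    double t = cong (t ℕ.+_) (sym (+-identityʳ t))
    hi′ : s + p < 2 * (suc R * p)
    hi′ = ≤-trans (≤-trans (≤-reflexive (sym (+-suc s p)))
      (+-monoʳ-≤ s (s≤s (m≤n⇒m≤1+n (m≤m+n p p))))) (≤-trans hi (≤-reflexive (double (suc R * p))))
    open Decomposition (left-sums R i s (≤-trans (≤-reflexive (sym (double p))) lo) hi′)

  -- Since T is a multiple of the period, x ↦ T - 1 - x carries inner left positions of colour j to
  -- right positions of colour σ j. Surjectivity of σ then reaches every colour.
  right-zone-sums : ∀ R i s → let p = 10 * M; T = suc R * p in
    p + p ≤ s → s + (2 + (p + p)) ≤ T + T → Sum (Zone right T i) s
  right-zone-sums R i s lo hi with σ-surjective i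
  ... | j , refl = (flip<T x<T , flipped inner-x x<T left-x) ⊹ (flip<T y<T , flipped inner-y y<T left-y) by flip-sum
    where
    open +-*-Solver
    p = 10 * M
    T = suc R * p
    s≤ : 2 + s ≤ T + T
    s≤ = ≤-trans (≤-trans (≤-reflexive (+-comm 2 s)) (+-monoʳ-≤ s (m≤m+n 2 (p + p)))) hi
    s′ = (T + T) ∸ (2 + s)
    s′+s : (2 + s) + s′ ≡ T + T
    s′+s = m+[n∸m]≡n s≤
    lo′ : 2 * p ≤ s′
    lo′ = +-cancelˡ-≤ (2 + s) _ _ (begin
      (2 + s) + 2 * p     ≡⟨ solve 2 (λ s p → (con 2 :+ s) :+ con 2 :* p := s :+ (con 2 :+ (p :+ p))) refl s p ⟩
      s + (2 + (p + p))   ≤⟨ hi ⟩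
      T + T               ≡⟨ sym s′+s ⟩
      (2 + s) + s′        ∎)
      where open ≤-Reasoning
    hi′ : s′ + p < 2 * T
    hi′ = begin-strict
      s′ + p          ≡⟨ +-comm s′ p ⟩
      p + s′          ≤⟨ +-monoˡ-≤ s′ (≤-trans (m≤m+n p p) lo) ⟩
      s + s′          <⟨ s≤s (n≤1+n _) ⟩
      (2 + s) + s′    ≡⟨ s′+s ⟩
      T + T           ≡⟨ cong (T ℕ.+_) (sym (+-identityʳ T)) ⟩
      2 * T           ∎
      where open ≤-Reasoning
    open Decomposition (left-sums R j s′ lo′ hi′)
    flip<T : ∀ {u} → u < T → T ∸ suc u < T
    flip<T u<T = ∸-monoʳ-< (s≤s z≤n) u<T
    flipped : ∀ {u} → Inner u → u < T → left u ≡ j → right (T ∸ suc u) ≡ σ j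
    flipped {u} inner u<T eq = trans (opposite-inner {u} (suc R) (m+[n∸m]≡n u<T) inner) (cong σ eq)
    flip-sum : (T ∸ suc x) + (T ∸ suc y) ≡ s
    flip-sum = +-cancelˡ-≡ (2 + s′) _ _ (begin
      (2 + s′) + ((T ∸ suc x) + (T ∸ suc y))
        ≡⟨ cong (λ t → (2 + t) + ((T ∸ suc x) + (T ∸ suc y))) (sym x+y≡s) ⟩
      (2 + (x + y)) + ((T ∸ suc x) + (T ∸ suc y))
        ≡⟨ solve 4 (λ x y a b → (con 2 :+ (x :+ y)) :+ (a :+ b) := (con 1 :+ x :+ a) :+ (con 1 :+ y :+ b)) refl x y (T ∸ suc x) (T ∸ suc y) ⟩
      (suc x + (T ∸ suc x)) + (suc y + (T ∸ suc y))
        ≡⟨ cong₂ _+_ (m+[n∸m]≡n x<T) (m+[n∸m]≡n y<T) ⟩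
      T + T
        ≡⟨ sym s′+s ⟩
      (2 + s) + s′
        ≡⟨ solve 2 (λ s t → (con 2 :+ s) :+ t := (con 2 :+ t) :+ s) refl s s′ ⟩
      (2 + s′) + s ∎)
      where open ≡-Reasoning

-- Sums of a class that follows a fringe and then a colouring

module _ {k : ℕ} where
  open Colourings k

  Has-++⁺ˡ : ∀ {l m i} (u : Vec (Fin k) l) {v : Vec (Fin k) m} {a} → Has i u a → Has i (u Vec.++ v) a
  Has-++⁺ˡ (c ∷ u) {a = zero}  q = q
  Has-++⁺ˡ (c ∷ u) {a = suc a} q = Has-++⁺ˡ u q

  Has-++⁺ʳ : ∀ {l m i} (u : Vec (Fin k) l) {v : Vec (Fin k) m} {a} → Has i v a → Has i (u Vec.++ v) (l + a)
  Has-++⁺ʳ []      q = q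
  Has-++⁺ʳ (c ∷ u) q = Has-++⁺ʳ u q

  Has-++⁻ : ∀ {l m i} (u : Vec (Fin k) l) {v : Vec (Fin k) m} {a} → Has i (u Vec.++ v) a →
    Has i u a ⊎ (∃[ b ] a ≡ l + b × Has i v b)
  Has-++⁻ []      q = inj₂ (_ , refl , q)
  Has-++⁻ (c ∷ u) {a = zero}  q = inj₁ q
  Has-++⁻ (c ∷ u) {a = suc a} q with Has-++⁻ u q
  ... | inj₁ r              = inj₁ r
  ... | inj₂ (b , refl , r) = inj₂ (b , refl , r)

  fromSequence : (ℕ → Fin k) → ∀ m → Vec (Fin k) m
  fromSequence g m = tabulate (g ∘ toℕ)

  Has-fromSequence⁺ : ∀ {i} g {m a} → a < m → g a ≡ i → Has i (fromSequence g m) a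
  Has-fromSequence⁺ g {suc m} {zero}  _         eq = eq
  Has-fromSequence⁺ g {suc m} {suc a} (s≤s a<m) eq = Has-fromSequence⁺ (g ∘ suc) a<m eq

  Has-fromSequence⁻ : ∀ {i} g {m a} → Has i (fromSequence g m) a → g a ≡ i
  Has-fromSequence⁻ g {suc m} {zero}  q = q
  Has-fromSequence⁻ g {suc m} {suc a} q = Has-fromSequence⁻ (g ∘ suc) {m} q

  Has-lookup⁺ : ∀ {m i} (v : Vec (Fin k) m) j → lookup v j ≡ i → Has i v (toℕ j)
  Has-lookup⁺ (c ∷ v) Fin.zero    eq = eq
  Has-lookup⁺ (c ∷ v) (Fin.suc j) eq = Has-lookup⁺ v j eq

  Has-lookup⁻ : ∀ {m i} (v : Vec (Fin k) m) {a} → Has i v a → ∃[ j ] toℕ j ≡ a × lookup v j ≡ i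
  Has-lookup⁻ (c ∷ v) {zero}  q = Fin.zero , refl , q
  Has-lookup⁻ (c ∷ v) {suc a} q with Has-lookup⁻ v q
  ... | j , refl , eq = Fin.suc j , refl , eq

  module HalfSums {N} (i : Fin k) (w : Vec (Fin k) N) (p T : ℕ) (Q : ℕ → Set)
    (zone : ∀ s → p + p ≤ s → s + (2 + (p + p)) ≤ T + T → Sum Q s)
    (middle : ∀ {a} → Has i w a → Q (T + a)) where

    -- The sums below 2T outside the window of `zone`. Their number depends on p alone, however long
    -- the fringe.
    fringe : List ℕ
    fringe = upTo (p + p) ++ map (T + T ∸_) (upTo (2 + (p + p)))

    missing : List ℕ
    missing = fringe ++ map (T + T ℕ.+_) (unmet i w)

    length-missing : length missing ≡ 2 + 4 * p + length (unmet i w)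
    length-missing = begin
      length missing
        ≡⟨ trans (length-++ fringe) (cong₂ _+_ (length-++ (upTo (p + p))) (length-map _ (unmet i w))) ⟩
      length (upTo (p + p)) + length (map (T + T ∸_) (upTo (2 + (p + p)))) + u
        ≡⟨ cong (_+ u) (cong₂ _+_ (length-upTo (p + p)) (trans (length-map (T + T ∸_) (upTo (2 + (p + p)))) (length-upTo (2 + (p + p))))) ⟩
      p + p + (2 + (p + p)) + u
        ≡⟨ solve 2 (λ p u → p :+ p :+ (con 2 :+ (p :+ p)) :+ u := con 2 :+ con 4 :* p :+ u) refl p u ⟩
      2 + 4 * p + u ∎
      where
      open ≡-Reasoning
      open +-*-Solver
      u = length (unmet i w)

    sums : ∀ s → s < T + T + N → s ∈ missing ⊎ Sum Q s
    sums s s< with s ℕ.<? T + T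
    ... | no s≮ = late
      where
      j = s ∸ (T + T)
      s≡ : T + T + j ≡ s
      s≡ = m+[n∸m]≡n (≮⇒≥ s≮)
      j<N : j < N
      j<N = +-cancelˡ-< (T + T) j N (subst (_< T + T + N) (sym s≡) s<)
      late : s ∈ missing ⊎ Sum Q s
      late with Meets? i w (suc j)
      ... | yes (a , s≤s a≤j , q , r) = inj₂ (middle q ⊹ middle r by (begin
          (T + a) + (T + (j ∸ a)) ≡⟨ solve 3 (λ T a b → (T :+ a) :+ (T :+ b) := T :+ T :+ (a :+ b)) refl T a (j ∸ a) ⟩
          T + T + (a + (j ∸ a))   ≡⟨ cong (T + T ℕ.+_) (m+[n∸m]≡n a≤j) ⟩
          T + T + j               ≡⟨ s≡ ⟩
          s                       ∎))
        where
        open ≡-Reasoning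
        open +-*-Solver
      ... | no ¬meets = inj₁ (∈-++⁺ʳ fringe (subst (_∈ map (T + T ℕ.+_) (unmet i w)) s≡
                          (∈-map⁺ (T + T ℕ.+_) (∈-filter⁺ _ (∈-upTo⁺ j<N) ¬meets))))
    ... | yes s<2T with s ℕ.<? p + p
    ... | yes s<2p = inj₁ (∈-++⁺ˡ (∈-++⁺ˡ (∈-upTo⁺ s<2p)))
    ... | no s≮2p with s + (2 + (p + p)) ℕ.≤? T + T
    ... | yes s≤ = inj₂ (zone s (≮⇒≥ s≮2p) s≤)
    ... | no s≰ = inj₁ (∈-++⁺ˡ (∈-++⁺ʳ (upTo (p + p)) (subst (_∈ map (T + T ∸_) (upTo (2 + (p + p))))
                    (m∸[m∸n]≡n (<⇒≤ s<2T)) (∈-map⁺ (T + T ∸_) (∈-upTo⁺ gap)))))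
      where
      gap : T + T ∸ s < 2 + (p + p)
      gap = +-cancelˡ-< s _ _ (subst (_< s + (2 + (p + p))) (sym (m+[n∸m]≡n (<⇒≤ s<2T))) (≰⇒> s≰))

-- Membership in the sets S_i by position

module Members {k m : ℕ} (n : ℕ) (A : Fin k → List ℤ) (v : Vec (Fin k) m) (i : Fin k) where
  open Colourings k

  ∈-prefix : ∀ {u} → u < n → + u ∈ A i → + u ∈ Sset n A v i
  ∈-prefix u<n u∈ = ∈-++⁺ˡ (∈-filter⁺ (λ x → x ℤ.<? + n) u∈ (ℤ.+<+ u<n))

  ∈-middle : ∀ {a} → Has i v a → + (n + a) ∈ Sset n A v i
  ∈-middle q with Has-lookup⁻ v q
  ... | j , refl , eq = ∈-++⁺ʳ (Lpart n (A i)) (∈-++⁺ˡ (∈-map⁺ (λ j → + n ℤ.+ + toℕ j)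
          (∈-filter⁺ (λ j → lookup v j Fin.≟ i) (∈-allFin j) eq)))

  ∈-suffix : ∀ {u} → n ≤ u → + u ∈ A i → + (u + m) ∈ Sset n A v i
  ∈-suffix n≤u u∈ = ∈-++⁺ʳ (Lpart n (A i)) (∈-++⁺ʳ (colourClass n v i) (∈-map⁺ (ℤ._+ + m)
          (∈-filter⁺ (λ x → + n ℤ.≤? x) u∈ (ℤ.+≤+ n≤u))))

  data Position : ℤ → Set where
    inPrefix : ∀ {u} → u < n → + u ∈ A i → Position (+ u)
    inMiddle : ∀ {a} → Has i v a → Position (+ (n + a))
    inSuffix : ∀ {u} → n ≤ u → + u ∈ A i → Position (+ (u + m))

  position⁻ : (∀ {x} → x ∈ A i → ∃[ u ] x ≡ + u) → ∀ {x} → x ∈ Sset n A v i → Position x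
  position⁻ A≥0 x∈ with ∈-++⁻ (Lpart n (A i)) x∈
  ... | inj₁ q with ∈-filter⁻ (λ x → x ℤ.<? + n) q
  ... | x∈A , x<n with A≥0 x∈A
  ... | u , refl = inPrefix (ℤₚ.drop‿+<+ x<n) x∈A
  position⁻ A≥0 x∈ | inj₂ q with ∈-++⁻ (colourClass n v i) q
  ... | inj₁ r with ∈-map⁻ (λ j → + n ℤ.+ + toℕ j) r
  ... | j , j∈ , refl = inMiddle (Has-lookup⁺ v j (proj₂ (∈-filter⁻ (λ j → lookup v j Fin.≟ i) {xs = allFin m} j∈)))
  position⁻ A≥0 x∈ | inj₂ q | inj₂ r with ∈-map⁻ (ℤ._+ + m) r
  ... | y , y∈ , refl with ∈-filter⁻ (λ x → + n ℤ.≤? x) y∈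
  ... | y∈A , n≤y with A≥0 y∈A
  ... | u , refl = inSuffix (ℤₚ.drop‿+≤+ n≤y) y∈A

-- Prescribed fringes around a free middle

module Construction (n₁ k : ℕ) (A : Fin k → List ℤ)
  (A⊆ : ∀ {i x} → x ∈ A i → ∃[ u ] u < suc n₁ + suc n₁ × x ≡ + u)
  (p R T T′ : ℕ) .{{_ : NonZero p}} (R*p≡T : R * p ≡ T) (n+T′≡T : suc n₁ + T′ ≡ T)
  (R-large : 4 + 8 * p + Colourings.defect-bound k < R + R)
  (left right : ℕ → Fin k)
  (opposite⇒≢ : ∀ {x z} c → suc (x + z) ≡ c * p → left x ≢ right z)
  (left-prefix⁺ : ∀ {u} → u < suc n₁ → + u ∈ A (left u))
  (left-prefix⁻ : ∀ {u i} → u < suc n₁ → + u ∈ A i → left u ≡ i)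
  (right-suffix⁺ : ∀ {u z} → u + suc z ≡ suc n₁ + suc n₁ → z < suc n₁ → + u ∈ A (right z))
  (right-suffix⁻ : ∀ {u z i} → u + suc z ≡ suc n₁ + suc n₁ → z < suc n₁ → + u ∈ A i → right z ≡ i)
  (left-zone-sums  : ∀ i s → p + p ≤ s → s + (2 + (p + p)) ≤ T + T → Sum (Zone left T i) s)
  (right-zone-sums : ∀ i s → p + p ≤ s → s + (2 + (p + p)) ≤ T + T → Sum (Zone right T i) s) where

  open Colourings k

  n : ℕ
  n = suc n₁

  n≤T : n ≤ T
  n≤T = ≤-trans (m≤m+n n T′) (≤-reflexive n+T′≡T)

  -- The outermost n positions of a fringe of length T belong to the A_i, so only T - n colours are
  -- left to prescribe. The right pattern counts from the right end, hence the index T - 1 - j.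
  leftFringe rightFringe : Vec (Fin k) T′
  leftFringe  = fromSequence (λ j → left (n + j)) T′
  rightFringe = fromSequence (λ j → right (T ∸ suc j)) T′

  module Extension {N : ℕ} (w : Vec (Fin k) N) where

    m : ℕ
    m = T′ + (N + T′)

    v : Vec (Fin k) m
    v = leftFringe Vec.++ (w Vec.++ rightFringe)

    S : Fin k → List ℤ
    S = Sset n A v

    -- In this form `suc W` computes to n + m + n, the length of the whole interval.
    W : ℕ
    W = n₁ + m + n

    W≡ : suc W ≡ T + N + T
    W≡ = begin
      n + (T′ + (N + T′)) + n   ≡⟨ solve 3 (λ n t N → n :+ (t :+ (N :+ t)) :+ n := (n :+ t) :+ N :+ (n :+ t)) refl n T′ N ⟩
      (n + T′) + N + (n + T′)   ≡⟨ cong₂ (λ a b → a + N + b) n+T′≡T n+T′≡T ⟩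
      T + N + T                 ∎
      where
      open ≡-Reasoning
      open +-*-Solver

    2T≤W+1 : T + T ≤ suc W
    2T≤W+1 = ≤-trans (+-monoˡ-≤ T (m≤m+n T N)) (≤-reflexive (sym W≡))

    module Coloured (i : Fin k) where
      open Members n A v i

      locate : ∀ {x} → x ∈ S i → Position x
      locate = position⁻ (λ x∈ → proj₁ (A⊆ x∈) , proj₂ (proj₂ (A⊆ x∈)))

      S⊆[0,W] : ∀ {x} → x ∈ S i → ∃[ u ] u ≤ W × x ≡ + u
      S⊆[0,W] x∈ with locate x∈
      ... | inPrefix {u} u<n _ = u , ≤-pred (≤-trans u<n (m≤n+m n (n + m))) , refl
      ... | inMiddle {a} q = n + a , ≤-pred (≤-trans (+-monoʳ-< n (Has⇒< v q)) (m≤m+n (n + m) n)) , refl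
      ... | inSuffix {u} _ u∈ with A⊆ u∈
      ... | u , u<2n , refl = u + m , ≤-pred (≤-trans (+-monoˡ-< m u<2n)
              (≤-reflexive (solve 2 (λ n m → n :+ n :+ m := n :+ m :+ n) refl n m))) , refl
        where open +-*-Solver

      -- This direction, with `right-colour`, excludes differences; the converses `left-member` and
      -- `right-member` supply sums.
      left-colour : ∀ {u} → u < T → + u ∈ S i → left u ≡ i
      left-colour {u} u<T u∈ = go u<T (locate u∈) refl
        where
        go : ∀ {u x} → u < T → Position x → x ≡ + u → left u ≡ i
        go u<T (inPrefix u<n u∈A) refl = left-prefix⁻ u<n u∈A
        go u<T (inMiddle {a} q) refl with Has-++⁻ leftFringe q
        ... | inj₁ r = Has-fromSequence⁻ (λ j → left (n + j)) {T′} r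
        ... | inj₂ (b , refl , _) = contradiction (<-≤-trans u<T (≤-trans (≤-reflexive (sym n+T′≡T)) (+-monoʳ-≤ n (m≤m+n T′ b)))) (<-irrefl refl)
        go u<T (inSuffix {u} n≤u _) refl = contradiction
          (<-≤-trans u<T (≤-trans (≤-reflexive (sym n+T′≡T)) (+-mono-≤ n≤u (m≤m+n T′ (N + T′))))) (<-irrefl refl)

      left-member : ∀ {u} → u < T → left u ≡ i → + u ∈ S i
      left-member {u} u<T eq with u ℕ.<? n
      ... | yes u<n = ∈-prefix u<n (subst (λ c → + u ∈ A c) eq (left-prefix⁺ u<n))
      ... | no u≮n = subst (λ t → + t ∈ S i) n+a≡u (∈-middle (Has-++⁺ˡ leftFringe
                       (Has-fromSequence⁺ (λ j → left (n + j)) a<T′ (trans (cong left n+a≡u) eq))))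
        where
        a = u ∸ n
        n+a≡u : n + a ≡ u
        n+a≡u = m+[n∸m]≡n (≮⇒≥ u≮n)
        a<T′ : a < T′
        a<T′ = +-cancelˡ-< n a T′ (≤-trans (s≤s (≤-reflexive n+a≡u)) (≤-trans u<T (≤-reflexive (sym n+T′≡T))))

      right-colour : ∀ {u z} → u + z ≡ W → z < T → + u ∈ S i → right z ≡ i
      right-colour {u} {z} u+z z<T u∈ = go u+z (locate u∈) refl
        where
        open +-*-Solver
        go : ∀ {u x} → u + z ≡ W → Position x → x ≡ + u → right z ≡ i
        go {u} u+z (inPrefix u<n _) refl = contradiction
          (+-cancelʳ-≤ T T z (begin
            T + T             ≤⟨ 2T≤W+1 ⟩
            suc W             ≡⟨ cong suc (sym u+z) ⟩
            suc u + z         ≤⟨ +-monoˡ-≤ z (≤-trans u<n n≤T) ⟩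
            T + z             ≡⟨ +-comm T z ⟩
            z + T             ∎)) (<⇒≱ z<T)
          where open ≤-Reasoning
        go u+z (inSuffix {u} n≤u u∈A) refl = right-suffix⁻ u+z′ z<n u∈A
          where
          u+z′ : u + suc z ≡ n + n
          u+z′ = +-cancelʳ-≡ m _ _ (begin
            u + suc z + m    ≡⟨ solve 3 (λ u z m → u :+ (con 1 :+ z) :+ m := con 1 :+ (u :+ m :+ z)) refl u z m ⟩
            suc (u + m + z)  ≡⟨ cong suc u+z ⟩
            n + m + n        ≡⟨ solve 2 (λ n m → n :+ m :+ n := n :+ n :+ m) refl n m ⟩
            n + n + m        ∎)
            where open ≡-Reasoning
          z<n : z < n
          z<n = +-cancelˡ-≤ n _ _ (≤-trans (+-monoˡ-≤ (suc z) n≤u) (≤-reflexive u+z′))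
        go u+z (inMiddle {a} q) refl = inner (Has-++⁻ leftFringe q)
          where
          a+z : suc (a + z) ≡ T′ + N + T
          a+z = +-cancelˡ-≡ n _ _ (begin
            n + suc (a + z)     ≡⟨ solve 3 (λ n a z → n :+ (con 1 :+ (a :+ z)) := con 1 :+ (n :+ a :+ z)) refl n a z ⟩
            suc (n + a + z)     ≡⟨ cong suc u+z ⟩
            suc W               ≡⟨ W≡ ⟩
            T + N + T           ≡⟨ cong (λ t → t + N + T) (sym n+T′≡T) ⟩
            n + T′ + N + T      ≡⟨ solve 4 (λ n t N T → n :+ t :+ N :+ T := n :+ (t :+ N :+ T)) refl n T′ N T ⟩
            n + (T′ + N + T)    ∎)
            where open ≡-Reasoning
          too-far : a < T′ + N → ⊥
          too-far a< = <⇒≱ z<T (+-cancelˡ-≤ (T′ + N) T z (≤-trans (≤-reflexive (sym a+z)) (+-monoˡ-≤ z a<)))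
          inner : Has i leftFringe a ⊎ (∃[ b ] a ≡ T′ + b × Has i (w Vec.++ rightFringe) b) → right z ≡ i
          inner (inj₁ r) = ⊥-elim (too-far (≤-trans (Has⇒< leftFringe r) (m≤m+n T′ N)))
          inner (inj₂ (b , refl , r)) with Has-++⁻ w r
          ... | inj₁ r′ = ⊥-elim (too-far (+-monoʳ-< T′ (Has⇒< w r′)))
          ... | inj₂ (b′ , refl , r′) = trans (cong right (sym (complementˡ b′ z b′+z))) (Has-fromSequence⁻ (λ j → right (T ∸ suc j)) {T′} r′)
            where
            b′+z : suc (b′ + z) ≡ T
            b′+z = +-cancelˡ-≡ (T′ + N) _ _ (trans
              (solve 4 (λ t N b z → t :+ N :+ (con 1 :+ (b :+ z)) := con 1 :+ (t :+ (N :+ b) :+ z)) refl T′ N b′ z) a+z)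

      right-member : ∀ {z} → z < T → right z ≡ i → ∃[ u ] u + z ≡ W × + u ∈ S i
      right-member {z} z<T eq with z ℕ.<? n
      ... | yes z<n = u + m , total , ∈-suffix n≤u (subst (λ c → + u ∈ A c) eq
                        (right-suffix⁺ (m∸n+n≡m z<2n) z<n))
        where
        open +-*-Solver
        z<2n = <-≤-trans z<n (m≤m+n n n)
        u = (n + n) ∸ suc z
        n≤u : n ≤ u
        n≤u = ≤-trans (≤-reflexive (sym (m+n∸n≡m n n))) (∸-monoʳ-≤ (n + n) z<n)
        total : u + m + z ≡ W
        total = suc-injective (begin
          suc (u + m + z)  ≡⟨ solve 3 (λ u m z → con 1 :+ (u :+ m :+ z) := (con 1 :+ z :+ u) :+ m) refl u m z ⟩
          suc z + u + m    ≡⟨ cong (_+ m) (m+[n∸m]≡n z<2n) ⟩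
          n + n + m        ≡⟨ solve 2 (λ n m → n :+ n :+ m := n :+ m :+ n) refl n m ⟩
          suc W            ∎)
          where open ≡-Reasoning
      ... | no z≮n = n + (T′ + (N + b)) , total , ∈-middle (Has-++⁺ʳ leftFringe (Has-++⁺ʳ w
                       (Has-fromSequence⁺ (λ j → right (T ∸ suc j)) b<T′ (trans (cong right (complementˡ b z (trans (cong suc (+-comm b z)) z+b))) eq))))
        where
        open +-*-Solver
        b = T ∸ suc z
        z+b : suc (z + b) ≡ T
        z+b = m+[n∸m]≡n z<T
        b<T′ : b < T′
        b<T′ = +-cancelˡ-< n b T′ (≤-trans (s≤s (+-monoˡ-≤ b (≮⇒≥ z≮n))) (≤-reflexive (trans z+b (sym n+T′≡T))))
        total : n + (T′ + (N + b)) + z ≡ W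
        total = suc-injective (begin
          suc (n + (T′ + (N + b)) + z)   ≡⟨ solve 5 (λ n t N b z → con 1 :+ (n :+ (t :+ (N :+ b)) :+ z) := (n :+ t) :+ N :+ (con 1 :+ (z :+ b))) refl n T′ N b z ⟩
          n + T′ + N + suc (z + b)       ≡⟨ cong₂ (λ s t → s + N + t) n+T′≡T z+b ⟩
          T + N + T                      ≡⟨ sym W≡ ⟩
          suc W                          ∎)
          where open ≡-Reasoning

      middle-member : ∀ {a} → Has i w a → + (T + a) ∈ S i
      middle-member {a} q = subst (λ t → + t ∈ S i) (trans (sym (+-assoc n T′ a)) (cong (_+ a) n+T′≡T))
        (∈-middle (Has-++⁺ʳ leftFringe (Has-++⁺ˡ w q)))

      middle-member-reversed : ∀ {a} → Has i (reverse w) a → ∃[ u ] u + (T + a) ≡ W × + u ∈ S i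
      middle-member-reversed {a} q = T + (N ∸ suc a) , suc-injective (begin
          suc (T + (N ∸ suc a) + (T + a))   ≡⟨ solve 3 (λ T b a → con 1 :+ (T :+ b :+ (T :+ a)) := T :+ (con 1 :+ a :+ b) :+ T) refl T (N ∸ suc a) a ⟩
          T + (suc a + (N ∸ suc a)) + T     ≡⟨ cong (λ t → T + t + T) (m+[n∸m]≡n (Has⇒< (reverse w) q)) ⟩
          T + N + T                         ≡⟨ sym W≡ ⟩
          suc W                             ∎) , middle-member (Has-reverse⁻ w q)
        where
        open ≡-Reasoning
        open +-*-Solver

      InLeft InRight : ℕ → Set
      InLeft  x = + x ∈ S i
      InRight z = ∃[ u ] u + z ≡ W × + u ∈ S i

      left-zone : ∀ s → p + p ≤ s → s + (2 + (p + p)) ≤ T + T → Sum InLeft s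
      left-zone s lo hi with left-zone-sums i s lo hi
      ... | (x<T , cx) ⊹ (y<T , cy) by eq = left-member x<T cx ⊹ left-member y<T cy by eq

      right-zone : ∀ s → p + p ≤ s → s + (2 + (p + p)) ≤ T + T → Sum InRight s
      right-zone s lo hi with right-zone-sums i s lo hi
      ... | (x<T , cx) ⊹ (y<T , cy) by eq = right-member x<T cx ⊹ right-member y<T cy by eq

      module LeftHalf = HalfSums i w p T InLeft left-zone middle-member

      module RightHalf = HalfSums i (reverse w) p T InRight right-zone middle-member-reversed

      missing : List ℕ
      missing = LeftHalf.missing ++ map (W + W ∸_) RightHalf.missing

      length-missing : length missing ≡ 4 + 8 * p + (length (unmet i w) + length (unmet i (reverse w)))
      length-missing = begin
        length missing
          ≡⟨ length-++ LeftHalf.missing ⟩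
        length LeftHalf.missing + length (map (W + W ∸_) RightHalf.missing)
          ≡⟨ cong₂ _+_ LeftHalf.length-missing (trans (length-map _ RightHalf.missing) RightHalf.length-missing) ⟩
        (2 + 4 * p + a) + (2 + 4 * p + b)
          ≡⟨ solve 3 (λ p a b → (con 2 :+ con 4 :* p :+ a) :+ (con 2 :+ con 4 :* p :+ b) := con 4 :+ con 8 :* p :+ (a :+ b)) refl p a b ⟩
        4 + 8 * p + (a + b) ∎
        where
        open ≡-Reasoning
        open +-*-Solver
        a = length (unmet i w)
        b = length (unmet i (reverse w))

      ⊕-member : ∀ {x y} → + x ∈ S i → + y ∈ S i → + (x + y) ∈ S i ⊕ S i
      ⊕-member x∈ y∈ = ∈-cartesianProductWith⁺ ℤ._+_ x∈ y∈

      half : ∀ {s} → s ≤ W → s < T + T + N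
      half s≤W = <-≤-trans (s≤s s≤W) (≤-reflexive (trans W≡ (solve 2 (λ T N → T :+ N :+ T := T :+ T :+ N) refl T N)))
        where open +-*-Solver

      -- A sum above W is reflected to 2W - s ≤ W and written as a sum of two distances from the
      -- right end.
      sums-covered : ∀ s → s ≤ W + W → s ∈ missing ⊎ + s ∈ S i ⊕ S i
      sums-covered s s≤2W with s ℕ.≤? W
      ... | yes s≤W with LeftHalf.sums s (half s≤W)
      ... | inj₁ s∈ = inj₁ (∈-++⁺ˡ s∈)
      ... | inj₂ (Qx ⊹ Qy by refl) = inj₂ (⊕-member Qx Qy)
      sums-covered s s≤2W | no s≰W with RightHalf.sums (W + W ∸ s)
          (half (≤-trans (∸-monoʳ-≤ (W + W) (<⇒≤ (≰⇒> s≰W))) (≤-reflexive (m+n∸n≡m W W))))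
      ... | inj₁ s∈ = inj₁ (∈-++⁺ʳ LeftHalf.missing (subst (_∈ map (W + W ∸_) RightHalf.missing)
                        (m∸[m∸n]≡n s≤2W) (∈-map⁺ (W + W ∸_) s∈)))
      ... | inj₂ (_⊹_by_ {x} {y} (u , u+x , u∈) (t , t+y , t∈) x+y) = inj₂ (subst (λ r → + r ∈ S i ⊕ S i) u+t (⊕-member u∈ t∈))
        where
        open +-*-Solver
        u+t : u + t ≡ s
        u+t = +-cancelʳ-≡ (W + W ∸ s) _ _ (begin
          u + t + (W + W ∸ s)     ≡⟨ cong (u + t ℕ.+_) (sym x+y) ⟩
          u + t + (x + y)         ≡⟨ solve 4 (λ u t x y → u :+ t :+ (x :+ y) := (u :+ x) :+ (t :+ y)) refl u t x y ⟩
          (u + x) + (t + y)       ≡⟨ cong₂ _+_ u+x t+y ⟩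
          W + W                   ≡⟨ sym (m+[n∸m]≡n s≤2W) ⟩
          s + (W + W ∸ s)         ∎)
          where open ≡-Reasoning

      gap : ℕ → ℕ
      gap j = ℕ.pred (suc j * p)

      suc-gap : ∀ j → suc (gap j) ≡ suc j * p
      suc-gap j = suc-pred (suc j * p) {{m*n≢0 (suc j) p}}

      -- This keeps both positions of a pair with x + z = `gap j` inside the fringes, where the
      -- colours are prescribed.
      gap<T : ∀ {j} → j < R → gap j < T
      gap<T {j} j<R = ≤-trans (≤-reflexive (suc-gap j)) (≤-trans (*-monoˡ-≤ p j<R) (≤-reflexive R*p≡T))

      T≤W : T ≤ W
      T≤W = ≤-pred (≤-trans (+-monoˡ-≤ T (≤-trans (s≤s z≤n) n≤T)) 2T≤W+1)

      absent : List ℕ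
      absent = applyUpTo (λ j → W ∸ gap j) R

      gap≤W : ∀ {j} → j < R → gap j ≤ W
      gap≤W j<R = ≤-trans (<⇒≤ (gap<T j<R)) T≤W

      absent! : Unique absent
      absent! = Uniqueₚ.applyUpTo⁺₁ _ R (λ {a} {b} a<b b<R eq → <⇒≢ a<b (suc-injective
        (*-cancelʳ-≡ (suc a) (suc b) p (trans (sym (suc-gap a)) (trans (cong suc
          (∸-cancelˡ-≡ (gap≤W (<-trans a<b b<R)) (gap≤W b<R) eq)) (suc-gap b))))))

      -- Positions x and W ∸ z at distance W ∸ gap j satisfy x + z = gap j, so they have different colours.
      absent-spec : ∀ {d} → d ∈ absent → 0 < d × d ≤ W × ¬ (+ d ∈ S i ⊖ S i)
      absent-spec d∈ with ∈-applyUpTo⁻ (λ j → W ∸ gap j) d∈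
      ... | j , j<R , refl = m<n⇒0<n∸m (<-≤-trans (gap<T j<R) T≤W) , m∸n≤m W (gap j) , not-difference
        where
        d = W ∸ gap j
        not-difference : ¬ (+ d ∈ S i ⊖ S i)
        not-difference d∈⊖ with ∈-cartesianProductWith⁻ ℤ._-_ (S i) (S i) d∈⊖
        ... | x , y , x∈ , y∈ , eq with S⊆[0,W] x∈ | S⊆[0,W] y∈
        ... | u , u≤W , refl | x′ , x′≤W , refl = opposite⇒≢ (suc j) (trans (cong suc x′+z) (suc-gap j))
            (trans (left-colour (≤-<-trans (m≤m+n x′ z) close) y∈)
              (sym (right-colour (m+[n∸m]≡n u≤W) (≤-<-trans (m≤n+m z x′) close) x∈)))
          where
          open +-*-Solver
          z = W ∸ u
          u≡ : u ≡ d + x′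
          u≡ = ℤₚ.+-injective (begin
            + u                         ≡⟨ sym (ℤₚ.+-identityʳ (+ u)) ⟩
            + u ℤ.+ ℤ.0ℤ                ≡⟨ cong (ℤ._+_ (+ u)) (sym (ℤₚ.+-inverseˡ (+ x′))) ⟩
            + u ℤ.+ (ℤ.- + x′ ℤ.+ + x′) ≡⟨ sym (ℤₚ.+-assoc (+ u) (ℤ.- + x′) (+ x′)) ⟩
            + u ℤ.- + x′ ℤ.+ + x′       ≡⟨ cong (λ t → t ℤ.+ + x′) (sym eq) ⟩
            + (d + x′)                  ∎)
            where open ≡-Reasoning
          x′+z : x′ + z ≡ gap j
          x′+z = +-cancelˡ-≡ d _ _ (begin
            d + (x′ + z)   ≡⟨ sym (+-assoc d x′ z) ⟩
            d + x′ + z     ≡⟨ cong (_+ z) (sym u≡) ⟩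
            u + z          ≡⟨ m+[n∸m]≡n u≤W ⟩
            W              ≡⟨ sym (m∸n+n≡m (gap≤W j<R)) ⟩
            d + gap j      ∎)
            where open ≡-Reasoning
          close : x′ + z < T
          close = subst (_< T) (sym x′+z) (gap<T j<R)

      mstd : defect w ≤ defect-bound → MSTD (S i)
      mstd defect≤ = Criterion.mstd (S i) W S⊆[0,W] absent missing absent! absent-spec sums-covered (begin-strict
        length missing
          ≡⟨ length-missing ⟩
        4 + 8 * p + (length (unmet i w) + length (unmet i (reverse w)))
          ≤⟨ +-monoʳ-≤ (4 + 8 * p) (≤-trans (∈⇒≤∑ (λ i → length (unmet i w) + length (unmet i (reverse w))) (∈-allFin i)) defect≤) ⟩
        4 + 8 * p + defect-bound
          <⟨ R-large ⟩
        R + R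
          ≡⟨ sym (cong₂ _+_ (length-applyUpTo _ R) (length-applyUpTo _ R)) ⟩
        length absent + length absent ∎)
        where open ≤-Reasoning

  m₀ : ℕ
  m₀ = T′ + T′

  -- The inverse of the final proportion: k to the number of prescribed colours, times the factor
  -- lost in Markov's inequality.
  scale : ℕ
  scale = suc defect-bound * k ^ m₀

  count-lower-bound : ∀ m → m₀ ≤ m → k ^ m ≤ scale * goodCount n k A m
  count-lower-bound m m₀≤m = subst (λ m → k ^ m ≤ scale * goodCount n k A m) m≡ (begin
    k ^ (T′ + (N + T′))
      ≡⟨ cong (k ^_) (solve 2 (λ t N → t :+ (N :+ t) := (t :+ t) :+ N) refl T′ N) ⟩
    k ^ (m₀ + N)
      ≡⟨ ^-distribˡ-+-* k m₀ N ⟩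
    k ^ m₀ * k ^ N
      ≤⟨ *-monoʳ-≤ (k ^ m₀) (defect-markov N (λ w → good? (Extension.v w)) (λ w defect≤ i → Extension.Coloured.mstd w i defect≤)) ⟩
    k ^ m₀ * (suc defect-bound * ∑c N (λ w → 𝟙 (good? (Extension.v w))))
      ≤⟨ *-monoʳ-≤ (k ^ m₀) (*-monoʳ-≤ (suc defect-bound) (≤-trans
           (∑c-≥-suffix N rightFringe (λ u → 𝟙 (good? (leftFringe Vec.++ u))))
           (∑c-≥-prefix (N + T′) leftFringe (𝟙 ∘ good?)))) ⟩
    k ^ m₀ * (suc defect-bound * ∑c (T′ + (N + T′)) (𝟙 ∘ good?))
      ≡⟨ solve 3 (λ a b c → a :* (b :* c) := b :* a :* c) refl (k ^ m₀) (suc defect-bound) (∑c (T′ + (N + T′)) (𝟙 ∘ good?)) ⟩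
    scale * ∑c (T′ + (N + T′)) (𝟙 ∘ good?)
      ≡⟨ cong (scale *_) (sym (length-filter-∑ good? (allColourings k (T′ + (N + T′))))) ⟩
    scale * goodCount n k A (T′ + (N + T′)) ∎)
    where
    open ≤-Reasoning
    open +-*-Solver
    N = m ∸ m₀
    m≡ : T′ + (N + T′) ≡ m
    m≡ = trans (solve 2 (λ t N → t :+ (N :+ t) := (t :+ t) :+ N) refl T′ N) (m+[n∸m]≡n m₀≤m)
    good? : ∀ {m} (v : Vec (Fin k) m) → Dec (∀ i → MSTD (Sset n A v i))
    good? v = all? (λ i → MSTD? (Sset n A v i))

-- Choice of the parameters

goodCount-lower-bound : ∀ n₁ k .{{_ : NonZero k}} (let n = suc n₁)
  (σ : Fin k → Fin k) → (∀ i → σ i ≢ i) → (∀ i → ∃[ j ] σ j ≡ i) →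
  (A : Fin k → List ℤ) →
  (∀ {i x} → x ∈ A i → ∃[ u ] u < n + n × x ≡ + u) →
  (colour : ℕ → Fin k) →
  (∀ {u} → u < n + n → + u ∈ A (colour u)) →
  (∀ {u i} → + u ∈ A i → colour u ≡ i) →
  ∃[ scale ] NonZero scale × ∃[ m₀ ] (∀ m → m₀ ≤ m → k ^ m ≤ scale * goodCount n k A m)
goodCount-lower-bound n₁ k σ σ-derangement σ-surjective A A⊆ colour ∈-colour colour-unique =
  C.scale , m*n≢0 (suc K) (k ^ C.m₀) {{_}} {{m^n≢0 k C.m₀}} , C.m₀ , C.count-lower-bound
  where
  open +-*-Solver
  n = suc n₁
  K = Colourings.defect-bound k
  -- With h = n + k both k ≤ h and n ≤ M hold, so the given n colours fit into block 0 at either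
  -- end.
  open Pattern k (n + k) (m≤n+m k n) σ σ-derangement σ-surjective colour (λ z → colour (n + n ∸ suc z))
  p = 10 * M
  -- The fringe has R₁ + 1 periods, and 2 (R₁ + 1) = 6 + 8 p + 2 K exceeds the 4 + 8 p + K sums that
  -- may be missed.
  R₁ = 2 + 4 * p + K
  T = suc R₁ * p
  n≤M : n ≤ M
  n≤M = ≤-trans (m≤m+n n k) (m≤n*m (n + k) k)
  n≤T : n ≤ T
  n≤T = ≤-trans n≤M (≤-trans (m≤n*m M 10) (m≤n*m p (suc R₁)))
  R-large : 4 + 8 * p + K < suc R₁ + suc R₁
  R-large = <-≤-trans (m≤n+m _ (suc K)) (≤-reflexive
    (solve 2 (λ p K → con 1 :+ K :+ (con 1 :+ (con 4 :+ con 8 :* p :+ K)) :=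
      (con 3 :+ con 4 :* p :+ K) :+ (con 3 :+ con 4 :* p :+ K)) refl p K))
  mirror : ∀ {u z} → u + suc z ≡ n + n → n + n ∸ suc z ≡ u
  mirror {u} {z} eq = trans (cong (_∸ suc z) (sym eq)) (m+n∸n≡m u (suc z))
  left-prefix′ : ∀ {u} → u < n → left u ≡ colour u
  left-prefix′ u<n = left-prefix (<-≤-trans u<n n≤M)
  right-suffix′ : ∀ {u z} → u + suc z ≡ n + n → z < n → right z ≡ colour u
  right-suffix′ eq z<n = trans (right-suffix (<-≤-trans z<n n≤M)) (cong colour (mirror eq))
  left-prefix⁺ : ∀ {u} → u < n → + u ∈ A (left u)
  left-prefix⁺ {u} u<n = subst (λ c → + u ∈ A c) (sym (left-prefix′ u<n)) (∈-colour (<-≤-trans u<n (m≤m+n n n)))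
  left-prefix⁻ : ∀ {u i} → u < n → + u ∈ A i → left u ≡ i
  left-prefix⁻ u<n u∈ = trans (left-prefix′ u<n) (colour-unique u∈)
  right-suffix⁺ : ∀ {u z} → u + suc z ≡ n + n → z < n → + u ∈ A (right z)
  right-suffix⁺ {u} eq z<n = subst (λ c → + u ∈ A c) (sym (right-suffix′ eq z<n))
    (∈-colour (≤-trans (m<m+n u (s≤s z≤n)) (≤-reflexive eq)))
  right-suffix⁻ : ∀ {u z i} → u + suc z ≡ n + n → z < n → + u ∈ A i → right z ≡ i
  right-suffix⁻ eq z<n u∈ = trans (right-suffix′ eq z<n) (colour-unique u∈)
  module C = Construction n₁ k A A⊆ p (suc R₁) T (T ∸ n) {{m*n≢0 10 M}} refl (m+[n∸m]≡n n≤T) R-large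
    left right opposite⇒≢ left-prefix⁺ left-prefix⁻ right-suffix⁺ right-suffix⁻
    (left-zone-sums R₁) (right-zone-sums R₁)

-- From a partition to a colour function

module DisjointCover (n₁ k : ℕ) (A : Fin (suc k) → List ℤ)
  (disjoint : ∀ i j → ¬ i ≡ j → ∀ x → x ∈ A i → ¬ x ∈ A j)
  (bounded : ∀ i x → x ∈ A i → InInterval (+ 0) (+ (2 * suc n₁) ℤ.- + 1) x)
  (covering : ∀ x → InInterval (+ 0) (+ (2 * suc n₁) ℤ.- + 1) x → ∃[ i ] x ∈ A i) where

  n : ℕ
  n = suc n₁

  2n≡ : 2 * n ≡ n + n
  2n≡ = cong (n ℕ.+_) (+-identityʳ n)

  A⊆ : ∀ {i x} → x ∈ A i → ∃[ u ] u < n + n × x ≡ + u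
  A⊆ {i} {x} x∈ with bounded i x x∈
  ... | ℤ.+≤+ {n = u} _ , ℤ.+≤+ u≤ = u , ≤-trans (s≤s u≤) (≤-reflexive 2n≡) , refl

  cover : ∀ {u} → u < n + n → ∃[ i ] + u ∈ A i
  cover {u} u<2n = covering (+ u) (ℤ.+≤+ z≤n , ℤ.+≤+ (≤-pred (≤-trans u<2n (≤-reflexive (sym 2n≡)))))

  colour : ℕ → Fin (suc k)
  colour u with u ℕ.<? n + n
  ... | yes u<2n = proj₁ (cover u<2n)
  -- Block 0 of the left pattern reads colours beyond 2n - 1 too. Any value is fine there, because
  -- the block facing it is computed from it.
  ... | no  _    = Fin.zero

  ∈-colour : ∀ {u} → u < n + n → + u ∈ A (colour u)
  ∈-colour {u} u<2n with u ℕ.<? n + n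
  ... | yes u<2n′ = proj₂ (cover u<2n′)
  ... | no  u≮2n  = contradiction u<2n u≮2n

  colour-unique : ∀ {u i} → + u ∈ A i → colour u ≡ i
  colour-unique {u} {i} u∈ with A⊆ u∈
  ... | _ , u<2n , refl with colour u Fin.≟ i
  ... | yes eq = eq
  ... | no neq = contradiction u∈ (disjoint (colour u) i neq (+ u) (∈-colour u<2n))

-- Among unnormalised rationals the product involves no reduction by a gcd, and cross-multiplication
-- turns the claim into x ≤ y D.
unit-fraction-≤ : ∀ D .{{_ : NonZero D}} {x y} → x ≤ D * y → (+ 1 ℚ./ D) ℚ.* toℚ (+ x) ℚ.≤ toℚ (+ y)
unit-fraction-≤ (suc d) {x} {y} x≤Dy = ℚₚ.toℚᵘ-cancel-≤
  (ℚᵘₚ.≤-respˡ-≃ (ℚᵘₚ.≃-sym (ℚᵘₚ.≃-trans (ℚₚ.toℚᵘ-homo-* (+ 1 ℚ./ suc d) (toℚ (+ x)))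
      (ℚᵘₚ.*-cong (ℚₚ.toℚᵘ-fromℚᵘ (ℚᵘ.mkℚᵘ (+ 1) d)) (ℚₚ.toℚᵘ-fromℚᵘ (ℚᵘ.mkℚᵘ (+ x) 0)))))
    (ℚᵘₚ.≤-respʳ-≃ (ℚᵘₚ.≃-sym (ℚₚ.toℚᵘ-fromℚᵘ (ℚᵘ.mkℚᵘ (+ y) 0)))
      (ℚᵘ.*≤* (cleared (ℤ.+≤+ x≤Dy)))))
  where
  cleared : + x ℤ.≤ + (suc d * y) → (+ 1 ℤ.* + x) ℤ.* + 1 ℤ.≤ + y ℤ.* + (suc d * 1)
  cleared le rewrite ℤₚ.*-identityʳ (+ 1 ℤ.* + x) | ℤₚ.*-identityˡ (+ x) | *-identityʳ (suc d)
    | sym (ℤₚ.pos-* y (suc d)) | *-comm y (suc d) = le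

theoremB4 : (n k : ℕ) → 1 ℕ.≤ n → 2 ℕ.≤ k →
    (A : Fin k → List ℤ) →
    (∀ i j → ¬ i ≡ j → ∀ x → x ∈ A i → ¬ x ∈ A j) →
    (∀ i → MSTD (A i)) →
    (∀ i → P n (A i)) →
    (∀ i x → x ∈ A i → InInterval (+ 0) (+ (2 ℕ.* n) ℤ.- + 1) x) →
    (∀ x → InInterval (+ 0) (+ (2 ℕ.* n) ℤ.- + 1) x → ∃[ i ] x ∈ A i) →
    (a : Fin k → ℤ) →
    (∀ i → IsLeast (Good n (Lpart n (A i)) (Rpart n (A i))) (a i)) →
    0ℚ ℚ.< 1ℚ ℚ.- sumFin k (λ i → f n (a i) (Lpart n (A i)) (Rpart n (A i))) →
    ∃[ c ] (0ℚ ℚ.< c × ∃[ m₀ ] (∀ m → m₀ ℕ.≤ m →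
    c ℚ.* toℚ (+ (k ^ m)) ℚ.≤ toℚ (+ goodCount n k A m)))
theoremB4 (suc n₁) (suc (suc k)) (s≤s _) (s≤s (s≤s _)) A disjoint _ _ bounded covering _ _ _ =
  let open DisjointCover n₁ (suc k) A disjoint bounded covering
      scale , scale≢0 , m₀ , bound = goodCount-lower-bound n₁ (suc (suc k))
        rotate rotate-derangement rotate-surjective A A⊆ colour ∈-colour colour-unique
  in (+ 1 ℚ./ scale) {{scale≢0}} , ℚₚ.positive⁻¹ _ {{ℚₚ.normalize-pos 1 scale {{scale≢0}}}} , m₀ ,
     λ m m₀≤m → unit-fraction-≤ scale {{scale≢0}} (bound m m₀≤m)
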